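{- For every integer $n\ge1$ there is an orientation (a signing $\sigma$ with values in $\{i,-i\}$) of the Hamming graph $H(n,4)$ such that the oriented graph $H(n,4)^\sigma$ has uniform mixing at time $t=\frac{\pi}{3\sqrt3}$; that is, with $A=A(H(n,4)^\sigma)$, every entry of the matrix $e^{ -itA}$ at $t=\frac{\pi}{3\sqrt3}$ has squared modulus $\frac{1}{4^n}$.
   Context: The Hamming graph $H(n,d)$ is the $n$-fold Cartesian product $K_d^{\Box n}$ of the complete graph $K_d$. The Cartesian product $X\Box Y$ has vertex set $V(X)\times V(Y)$ and adjacency matrix $A(X)\otimes I+I\otimes A(Y)$. A signing $\sigma$ of a graph $X$ assigns nonzero complex numbers to the edges so that the matrix $A(X^\sigma)$ with $(a,b)$-entry $\sigma(ab)$ if $ab\in E(X)$, and $0$ otherwise, is Hermitian. If $\sigma$ takes values in $\{i,-i\}$ then $X^\sigma$ is called an oriented graph. For a graph $X$ of order $N$ with Hermitian adjacency matrix $A$, the continuous-time quantum walk is $U_X(t)=e^{ -itA}$ and the mixing matrix is $M_X(t)=U_X(t)\circ\overline{U_X(t)}$ (entrywise product). $X$ has uniform mixing at time $t$ if $M_X(t)=\frac1NJ_N$, where $J_N$ is the all-one matrix. -}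

module Defs where

open import Data.Bool using (true; false; if_then_else_)
open import Data.Fin using (Fin; quotient; remainder)
import Data.Fin as Fin
open import Data.Fin.Properties using (nonZeroIndex)
open import Data.Integer using (+_)
open import Data.Nat using (ℕ; zero; suc; NonZero)
import Data.Nat as ℕ
import Data.Nat.Properties as ℕₚ
open import Data.Product using (∃-syntax; Σ-syntax; _×_; _,_; proj₁; proj₂)
open import Data.Rational using (ℚ; 0ℚ; 1ℚ)
import Data.Rational as ℚ
import Data.Rational.Properties as ℚₚ
open import Data.Rational.Solver using (module +-*-Solver)
open import Data.Sum using (_⊎_; inj₁; inj₂)
import Data.Vec.Functional as Vector
open import Relation.Binary.PropositionalEquality
open import Relation.Nullary using (¬_; Dec; yes; no; does; contradiction)
open import Relation.Nullary.Decidable using (¬?; _×-dec_; _⊎-dec_)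

infixl 7 _*ᴿ_ _*ᶜ_ _*ᴹ_ _·ᴹ_ _⊗_
infixl 6 _+ᴿ_ _-ᴿ_ _+ᶜ_
infix  8 -ᴿ_ -ᶜ_
infixr 9 _^ᴿ_ _^ᴹ_
infix  4 _≈ᴿ_ _<ᴿ_ _≈ᶜ_ _⟶_ _⟶ᶜ_

IsCauchy : (ℕ → ℚ) → Set
IsCauchy x = ∀ ε → 0ℚ ℚ.< ε →
  ∃[ N ] (∀ m n → N ℕ.≤ m → N ℕ.≤ n → ℚ.∣ x m ℚ.- x n ∣ ℚ.< ε)

record ℝ : Set where
  constructor mkℝ
  field
    seq    : ℕ → ℚ
    cauchy : IsCauchy seq
open ℝ public

_≈ᴿ_ : ℝ → ℝ → Set
x ≈ᴿ y = ∀ ε → 0ℚ ℚ.< ε →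
  ∃[ N ] (∀ n → N ℕ.≤ n → ℚ.∣ seq x n ℚ.- seq y n ∣ ℚ.< ε)

_<ᴿ_ : ℝ → ℝ → Set
x <ᴿ y = ∃[ ε ] (0ℚ ℚ.< ε × ∃[ N ] (∀ n → N ℕ.≤ n → ε ℚ.< seq y n ℚ.- seq x n))

private
  open +-*-Solver using (solve; _:+_; _:*_; _:-_; :-_; _:=_)

  positive-* : ∀ p ε .{{_ : ℚ.Positive p}} → 0ℚ ℚ.< ε → 0ℚ ℚ.< p ℚ.* ε
  positive-* p ε 0<ε =
    subst (λ z → z ℚ.< p ℚ.* ε) (ℚₚ.*-zeroʳ p) (ℚₚ.*-monoʳ-<-pos p 0<ε)

  half+half : ∀ ε → ℚ.½ ℚ.* ε ℚ.+ ℚ.½ ℚ.* ε ≡ ε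
  half+half ε = trans (sym (ℚₚ.*-distribʳ-+ ε ℚ.½ ℚ.½)) (ℚₚ.*-identityˡ ε)

  rearrange-+ : ∀ a b c d → (a ℚ.+ b) ℚ.- (c ℚ.+ d) ≡ (a ℚ.- c) ℚ.+ (b ℚ.- d)
  rearrange-+ = solve 4 (λ a b c d →
    (a :+ b) :- (c :+ d) := (a :- c) :+ (b :- d)) refl

  rearrange-neg : ∀ a b → ℚ.- a ℚ.- ℚ.- b ≡ ℚ.- (a ℚ.- b)
  rearrange-neg = solve 2 (λ a b → :- a :- :- b := :- (a :- b)) refl

  rearrange-* : ∀ a b c d →
    a ℚ.* b ℚ.- c ℚ.* d ≡ a ℚ.* (b ℚ.- d) ℚ.+ d ℚ.* (a ℚ.- c)
  rearrange-* = solve 4 (λ a b c d →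
    a :* b :- c :* d := a :* (b :- d) :+ d :* (a :- c)) refl

  split : ∀ a b → a ≡ (a ℚ.- b) ℚ.+ b
  split = solve 2 (λ a b → a := (a :- b) :+ b) refl

+-cauchy : ∀ x y → IsCauchy x → IsCauchy y → IsCauchy (λ n → x n ℚ.+ y n)
+-cauchy x y cx cy ε 0<ε 
  with cx _ (positive-* ℚ.½ ε 0<ε) | cy _ (positive-* ℚ.½ ε 0<ε)
... | N₁ , p | N₂ , q = N₁ ℕ.⊔ N₂ , λ m n N≤m N≤n → begin-strict
  ℚ.∣ (x m ℚ.+ y m) ℚ.- (x n ℚ.+ y n) ∣
    ≡⟨ cong ℚ.∣_∣ (rearrange-+ (x m) (y m) (x n) (y n)) ⟩
  ℚ.∣ (x m ℚ.- x n) ℚ.+ (y m ℚ.- y n) ∣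
    ≤⟨ ℚₚ.∣p+q∣≤∣p∣+∣q∣ (x m ℚ.- x n) (y m ℚ.- y n) ⟩
  ℚ.∣ x m ℚ.- x n ∣ ℚ.+ ℚ.∣ y m ℚ.- y n ∣
    <⟨ ℚₚ.+-mono-< (p m n (ℕₚ.m⊔n≤o⇒m≤o N₁ N₂ N≤m) (ℕₚ.m⊔n≤o⇒m≤o N₁ N₂ N≤n))
                   (q m n (ℕₚ.m⊔n≤o⇒n≤o N₁ N₂ N≤m) (ℕₚ.m⊔n≤o⇒n≤o N₁ N₂ N≤n)) ⟩
  ℚ.½ ℚ.* ε ℚ.+ ℚ.½ ℚ.* ε
    ≡⟨ half+half ε ⟩
  ε ∎
  where open ℚₚ.≤-Reasoning

neg-cauchy : ∀ x → IsCauchy x → IsCauchy (λ n → ℚ.- x n)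
neg-cauchy x cx ε 0<ε with cx ε 0<ε
... | N , p = N , λ m n N≤m N≤n →
  subst (ℚ._< ε)
    (sym (trans (cong ℚ.∣_∣ (rearrange-neg (x m) (x n))) (ℚₚ.∣-p∣≡∣p∣ (x m ℚ.- x n))))
    (p m n N≤m N≤n)

cauchy⇒bounded : ∀ x → IsCauchy x →
  ∃[ B ] (0ℚ ℚ.< B × ∃[ N ] (∀ n → N ℕ.≤ n → ℚ.∣ x n ∣ ℚ.≤ B))
cauchy⇒bounded x cx with cx 1ℚ (ℚₚ.positive⁻¹ 1ℚ)
... | N , p = 1ℚ ℚ.+ ℚ.∣ x N ∣
  , ℚₚ.+-mono-<-≤ (ℚₚ.positive⁻¹ 1ℚ) (ℚₚ.0≤∣p∣ (x N))
  , N , λ n N≤n → begin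
  ℚ.∣ x n ∣                           ≡⟨ cong ℚ.∣_∣ (split (x n) (x N)) ⟩
  ℚ.∣ (x n ℚ.- x N) ℚ.+ x N ∣         ≤⟨ ℚₚ.∣p+q∣≤∣p∣+∣q∣ (x n ℚ.- x N) (x N) ⟩
  ℚ.∣ x n ℚ.- x N ∣ ℚ.+ ℚ.∣ x N ∣
    ≤⟨ ℚₚ.+-monoˡ-≤ ℚ.∣ x N ∣ (ℚₚ.<⇒≤ (p n N N≤n ℕₚ.≤-refl)) ⟩
  1ℚ ℚ.+ ℚ.∣ x N ∣ ∎
  where open ℚₚ.≤-Reasoning

private
  rescale : ∀ B ε → 0ℚ ℚ.< B → 0ℚ ℚ.< ε → ∃[ δ ] (0ℚ ℚ.< δ × B ℚ.* δ ≡ ε)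
  rescale B ε 0<B 0<ε = 1/B ℚ.* ε
    , positive-* 1/B ε {{ℚₚ.1/pos⇒pos B}} 0<ε
    , trans (sym (ℚₚ.*-assoc B 1/B ε))
            (trans (cong (ℚ._* ε) (ℚₚ.*-inverseʳ B)) (ℚₚ.*-identityˡ ε))
    where
    instance
      B-pos : ℚ.Positive B
      B-pos = ℚ.positive 0<B
      B≢0 : ℚ.NonZero B
      B≢0 = ℚₚ.pos⇒nonZero B
    1/B : ℚ
    1/B = ℚ.1/ B

  ∣*∣-< : ∀ a b {C δ} → 0ℚ ℚ.< C → ℚ.∣ a ∣ ℚ.≤ C → ℚ.∣ b ∣ ℚ.< δ →
          ℚ.∣ a ℚ.* b ∣ ℚ.< C ℚ.* δ
  ∣*∣-< a b {C} {δ} 0<C a≤C b<δ = begin-strict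
    ℚ.∣ a ℚ.* b ∣         ≡⟨ ℚₚ.∣p*q∣≡∣p∣*∣q∣ a b ⟩
    ℚ.∣ a ∣ ℚ.* ℚ.∣ b ∣   ≤⟨ ℚₚ.*-monoʳ-≤-nonNeg ℚ.∣ b ∣ {{ℚₚ.∣-∣-nonNeg b}} a≤C ⟩
    C ℚ.* ℚ.∣ b ∣         <⟨ ℚₚ.*-monoʳ-<-pos C {{ℚ.positive 0<C}} b<δ ⟩
    C ℚ.* δ               ∎
    where open ℚₚ.≤-Reasoning

  ∣*-*∣-< : ∀ a b c d B₁ B₂ δ → 0ℚ ℚ.< B₁ → 0ℚ ℚ.< B₂ →
            ℚ.∣ a ∣ ℚ.≤ B₁ → ℚ.∣ d ∣ ℚ.≤ B₂ →
            ℚ.∣ a ℚ.- c ∣ ℚ.< δ → ℚ.∣ b ℚ.- d ∣ ℚ.< δ →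
            ℚ.∣ a ℚ.* b ℚ.- c ℚ.* d ∣ ℚ.< (B₁ ℚ.+ B₂) ℚ.* δ
  ∣*-*∣-< a b c d B₁ B₂ δ 0<B₁ 0<B₂ a≤B₁ d≤B₂ a-c<δ b-d<δ = begin-strict
    ℚ.∣ a ℚ.* b ℚ.- c ℚ.* d ∣
      ≡⟨ cong ℚ.∣_∣ (rearrange-* a b c d) ⟩
    ℚ.∣ a ℚ.* (b ℚ.- d) ℚ.+ d ℚ.* (a ℚ.- c) ∣
      ≤⟨ ℚₚ.∣p+q∣≤∣p∣+∣q∣ (a ℚ.* (b ℚ.- d)) (d ℚ.* (a ℚ.- c)) ⟩
    ℚ.∣ a ℚ.* (b ℚ.- d) ∣ ℚ.+ ℚ.∣ d ℚ.* (a ℚ.- c) ∣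
      <⟨ ℚₚ.+-mono-< {ℚ.∣ a ℚ.* (b ℚ.- d) ∣} {B₁ ℚ.* δ} {ℚ.∣ d ℚ.* (a ℚ.- c) ∣} {B₂ ℚ.* δ}
           (∣*∣-< a (b ℚ.- d) 0<B₁ a≤B₁ b-d<δ)
           (∣*∣-< d (a ℚ.- c) 0<B₂ d≤B₂ a-c<δ) ⟩
    B₁ ℚ.* δ ℚ.+ B₂ ℚ.* δ
      ≡⟨ ℚₚ.*-distribʳ-+ δ B₁ B₂ ⟨
    (B₁ ℚ.+ B₂) ℚ.* δ ∎
    where open ℚₚ.≤-Reasoning

*-cauchy : ∀ x y → IsCauchy x → IsCauchy y → IsCauchy (λ n → x n ℚ.* y n)
*-cauchy x y cx cy ε 0<ε =
  let B₁ , 0<B₁ , N₁ , b₁ = cauchy⇒bounded x cx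
      B₂ , 0<B₂ , N₂ , b₂ = cauchy⇒bounded y cy
      δ , 0<δ , Bδ≡ε      = rescale (B₁ ℚ.+ B₂) ε (ℚₚ.+-mono-< 0<B₁ 0<B₂) 0<ε
      M₁ , q₁             = cx δ 0<δ
      M₂ , q₂             = cy δ 0<δ
  in (N₁ ℕ.⊔ M₁) ℕ.⊔ (N₂ ℕ.⊔ M₂) , λ m n N≤m N≤n →
  let xm , ym = thresholds N₁ M₁ N₂ M₂ N≤m
      xn , yn = thresholds N₁ M₁ N₂ M₂ N≤n
  in subst (ℚ.∣ x m ℚ.* y m ℚ.- x n ℚ.* y n ∣ ℚ.<_) Bδ≡ε
       (∣*-*∣-< (x m) (y m) (x n) (y n) B₁ B₂ δ 0<B₁ 0<B₂
         (b₁ m (proj₁ xm)) (b₂ n (proj₁ yn))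
         (q₁ m n (proj₂ xm) (proj₂ xn)) (q₂ m n (proj₂ ym) (proj₂ yn)))
  where
  thresholds : ∀ N₁ M₁ N₂ M₂ {k} → (N₁ ℕ.⊔ M₁) ℕ.⊔ (N₂ ℕ.⊔ M₂) ℕ.≤ k →
               (N₁ ℕ.≤ k × M₁ ℕ.≤ k) × (N₂ ℕ.≤ k × M₂ ℕ.≤ k)
  thresholds N₁ M₁ N₂ M₂ p =
      (ℕₚ.m⊔n≤o⇒m≤o N₁ M₁ p₁ , ℕₚ.m⊔n≤o⇒n≤o N₁ M₁ p₁)
    , (ℕₚ.m⊔n≤o⇒m≤o N₂ M₂ p₂ , ℕₚ.m⊔n≤o⇒n≤o N₂ M₂ p₂)
    where
    p₁ = ℕₚ.m⊔n≤o⇒m≤o (N₁ ℕ.⊔ M₁) (N₂ ℕ.⊔ M₂) p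
    p₂ = ℕₚ.m⊔n≤o⇒n≤o (N₁ ℕ.⊔ M₁) (N₂ ℕ.⊔ M₂) p

fromℚ : ℚ → ℝ
fromℚ q = mkℝ (λ _ → q) λ ε 0<ε → 0 , λ _ _ _ _ →
  subst (ℚ._< ε) (cong ℚ.∣_∣ (sym (ℚₚ.+-inverseʳ q))) 0<ε

0ᴿ 1ᴿ 3ᴿ : ℝ
0ᴿ = fromℚ 0ℚ
1ᴿ = fromℚ 1ℚ
3ᴿ = fromℚ (+ 3 ℚ./ 1)

_+ᴿ_ : ℝ → ℝ → ℝ
x +ᴿ y = mkℝ (λ n → seq x n ℚ.+ seq y n) (+-cauchy (seq x) (seq y) (cauchy x) (cauchy y))

-ᴿ_ : ℝ → ℝ
-ᴿ x = mkℝ (λ n → ℚ.- seq x n) (neg-cauchy (seq x) (cauchy x))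

_-ᴿ_ : ℝ → ℝ → ℝ
x -ᴿ y = x +ᴿ -ᴿ y

_*ᴿ_ : ℝ → ℝ → ℝ
x *ᴿ y = mkℝ (λ n → seq x n ℚ.* seq y n) (*-cauchy (seq x) (seq y) (cauchy x) (cauchy y))

_^ᴿ_ : ℝ → ℕ → ℝ
x ^ᴿ zero  = 1ᴿ
x ^ᴿ suc k = x *ᴿ x ^ᴿ k

1/!_ : ℕ → ℝ
1/! k = fromℚ ((+ 1 ℚ./ k ℕ.!) {{k ℕₚ.!≢0}})

-- The two conjuncts say ∣ f n - L ∣ < ε; rational ε suffice.
_⟶_ : (ℕ → ℝ) → ℝ → Set
f ⟶ L = ∀ ε → 0ℚ ℚ.< ε →
  ∃[ N ] (∀ n → N ℕ.≤ n → (f n -ᴿ L <ᴿ fromℚ ε) × (L -ᴿ f n <ᴿ fromℚ ε))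

partialSum : {A : Set} → A → (A → A → A) → (ℕ → A) → ℕ → A
partialSum 0# _+_ f zero    = 0#
partialSum 0# _+_ f (suc n) = partialSum 0# _+_ f n + f n

sinTerm : ℝ → ℕ → ℝ
sinTerm x k = (-ᴿ 1ᴿ) ^ᴿ k *ᴿ 1/! (suc (2 ℕ.* k)) *ᴿ x ^ᴿ suc (2 ℕ.* k)

-- s = sin x: existence of the limit is not presupposed, and it is unique up to _≈ᴿ_.
IsSin : ℝ → ℝ → Set
IsSin x s = partialSum 0ᴿ _+ᴿ_ (sinTerm x) ⟶ s

-- π is the least positive zero of the sine function
IsPi : ℝ → Set
IsPi π = 0ᴿ <ᴿ π
       × IsSin π 0ᴿ
       × (∀ x → 0ᴿ <ᴿ x → x <ᴿ π → ¬ IsSin x 0ᴿ)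

IsPositiveSqrt : ℝ → ℝ → Set
IsPositiveSqrt x r = 0ᴿ <ᴿ r × r *ᴿ r ≈ᴿ x

record ℂ : Set where
  constructor _+i_
  field
    re im : ℝ
open ℂ public

_≈ᶜ_ : ℂ → ℂ → Set
z ≈ᶜ w = re z ≈ᴿ re w × im z ≈ᴿ im w

fromℝ : ℝ → ℂ
fromℝ x = x +i 0ᴿ

0ᶜ 1ᶜ 𝕚 : ℂ
0ᶜ = fromℝ 0ᴿ
1ᶜ = fromℝ 1ᴿ
𝕚  = 0ᴿ +i 1ᴿ

_+ᶜ_ _*ᶜ_ : ℂ → ℂ → ℂ
(a +i b) +ᶜ (c +i d) = (a +ᴿ c) +i (b +ᴿ d)
(a +i b) *ᶜ (c +i d) = (a *ᴿ c -ᴿ b *ᴿ d) +i (a *ᴿ d +ᴿ b *ᴿ c)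

-ᶜ_ : ℂ → ℂ
-ᶜ (a +i b) = (-ᴿ a) +i (-ᴿ b)

conj : ℂ → ℂ
conj (a +i b) = a +i (-ᴿ b)

_⟶ᶜ_ : (ℕ → ℂ) → ℂ → Set
f ⟶ᶜ L = ((λ n → re (f n)) ⟶ re L) × ((λ n → im (f n)) ⟶ im L)

Matrix : Set → ℕ → Set
Matrix A n = Fin n → Fin n → A

_*ᴹ_ : ∀ {n} → Matrix ℂ n → Matrix ℂ n → Matrix ℂ n
(A *ᴹ B) a b = Vector.foldr _+ᶜ_ 0ᶜ (λ c → A a c *ᶜ B c b)

_·ᴹ_ : ∀ {n} → ℂ → Matrix ℂ n → Matrix ℂ n
(z ·ᴹ A) a b = z *ᶜ A a b

_^ᴹ_ : ∀ {n} → Matrix ℂ n → ℕ → Matrix ℂ n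
(A ^ᴹ zero)  a b = if does (a Fin.≟ b) then 1ᶜ else 0ᶜ
(A ^ᴹ suc k)     = A *ᴹ A ^ᴹ k

IsHermitian : ∀ {n} → Matrix ℂ n → Set
IsHermitian A = ∀ a b → A b a ≈ᶜ conj (A a b)

-- U = e^B, where e^B is the sum of the series Σ B^k / k!
IsExp : ∀ {n} → Matrix ℂ n → Matrix ℂ n → Set
IsExp B U = ∀ a b →
  partialSum 0ᶜ _+ᶜ_ (λ k → (fromℝ (1/! k) ·ᴹ B ^ᴹ k) a b) ⟶ᶜ U a b

record Graph : Set₁ where
  field
    order  : ℕ
    Adj    : Fin order → Fin order → Set
    adj?   : ∀ a b → Dec (Adj a b)
    symm   : ∀ {a b} → Adj a b → Adj b a
    irrefl : ∀ {a} → ¬ Adj a a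
open Graph public

K : ℕ → Graph
K d = record
  { order  = d
  ; Adj    = _≢_
  ; adj?   = λ a b → ¬? (a Fin.≟ b)
  ; symm   = ≢-sym
  ; irrefl = λ a≢a → a≢a refl
  }

-- The vertex pairs (x , y) are numbered by remQuot : Fin (m * n) → Fin m × Fin n.
infixr 7 _□_
_□_ : Graph → Graph → Graph
X □ Y = record
  { order  = order X ℕ.* order Y
  ; Adj    = λ a b → (Adj X (fst a) (fst b) × snd a ≡ snd b)
                   ⊎ (fst a ≡ fst b × Adj Y (snd a) (snd b))
  ; adj?   = λ a b → (adj? X (fst a) (fst b) ×-dec (snd a Fin.≟ snd b))
               ⊎-dec ((fst a Fin.≟ fst b) ×-dec adj? Y (snd a) (snd b))
  ; symm   = λ { (inj₁ (e , p)) → inj₁ (symm X e , sym p)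
               ; (inj₂ (p , e)) → inj₂ (sym p , symm Y e) }
  ; irrefl = λ { (inj₁ (e , _)) → irrefl X e
               ; (inj₂ (_ , e)) → irrefl Y e }
  }
  where
  fst : Fin (order X ℕ.* order Y) → Fin (order X)
  fst = quotient (order Y)
  snd : Fin (order X ℕ.* order Y) → Fin (order Y)
  snd = remainder {order X} (order Y)

_□^_ : Graph → ℕ → Graph
X □^ 0           = K 1
X □^ 1           = X
X □^ suc (suc n) = X □ (X □^ suc n)

H : ℕ → ℕ → Graph
H n d = K d □^ n

order-H : ∀ n d → order (H n d) ≡ d ℕ.^ n
order-H 0             d = refl
order-H 1             d = sym (ℕₚ.*-identityʳ d)
order-H (suc (suc n)) d = cong (d ℕ.*_) (order-H (suc n) d)

indicator : {P : Set} → Dec P → ℕ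
indicator P? = if does P? then 1 else 0

identity : ∀ n → Matrix ℕ n
identity n a b = indicator (a Fin.≟ b)

adjacencyMatrix : (X : Graph) → Matrix ℕ (order X)
adjacencyMatrix X a b = indicator (adj? X a b)

_⊗_ : ∀ {m n} → Matrix ℕ m → Matrix ℕ n → Matrix ℕ (m ℕ.* n)
_⊗_ {m} {n} A B a b =
  A (quotient n a) (quotient n b) ℕ.* B (remainder {m} n a) (remainder {m} n b)

adjacencyMatrix-□ : ∀ X Y a b →
  adjacencyMatrix (X □ Y) a b
    ≡ (adjacencyMatrix X ⊗ identity (order Y)) a b
      ℕ.+ (identity (order X) ⊗ adjacencyMatrix Y) a b
adjacencyMatrix-□ X Y a b
  with adj? X x x′ | x Fin.≟ x′ | y Fin.≟ y′ | adj? Y y y′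
  where
  x  = quotient {order X} (order Y) a
  x′ = quotient {order X} (order Y) b
  y  = remainder {order X} (order Y) a
  y′ = remainder {order X} (order Y) b
... | yes e | yes p | _     | _     = contradiction (subst (Adj X _) (sym p) e) (irrefl X)
... | _     | _     | yes p | yes e = contradiction (subst (Adj Y _) (sym p) e) (irrefl Y)
... | yes _ | no _  | yes _ | no _  = refl
... | yes _ | no _  | no _  | yes _ = refl
... | yes _ | no _  | no _  | no _  = refl
... | no _  | yes _ | yes _ | no _  = refl
... | no _  | yes _ | no _  | yes _ = refl
... | no _  | yes _ | no _  | no _  = refl
... | no _  | no _  | yes _ | no _  = refl
... | no _  | no _  | no _  | yes _ = refl
... | no _  | no _  | no _  | no _  = refl

signedMatrix : (X : Graph) → Matrix ℂ (order X) → Matrix ℂ (order X)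
signedMatrix X σ a b = if does (adj? X a b) then σ a b else 0ᶜ

-- The values of weight at non-adjacent pairs are irrelevant.
record Signing (X : Graph) : Set where
  field
    weight    : Fin (order X) → Fin (order X) → ℂ
    nonzero   : ∀ a b → Adj X a b → ¬ (weight a b ≈ᶜ 0ᶜ)
    hermitian : IsHermitian (signedMatrix X weight)

  matrix : Matrix ℂ (order X)
  matrix = signedMatrix X weight
open Signing public

IsOrientation : ∀ {X} → Signing X → Set
IsOrientation {X} σ = ∀ a b → Adj X a b → weight σ a b ≈ᶜ 𝕚 ⊎ weight σ a b ≈ᶜ -ᶜ 𝕚

mixingMatrix : ∀ {n} → Matrix ℂ n → Matrix ℂ n
mixingMatrix U a b = U a b *ᶜ conj (U a b)

1/order : ∀ {n} → Fin n → ℚ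
1/order {n} a = (+ 1 ℚ./ n) {{nonZeroIndex a}}

HasUniformMixing : ∀ {n} → Matrix ℂ n → ℝ → Set
HasUniformMixing {n} A t =
  Σ[ U ∈ Matrix ℂ n ]
    IsExp ((-ᶜ (𝕚 *ᶜ fromℝ t)) ·ᴹ A) U
    × (∀ a b → mixingMatrix U a b ≈ᶜ fromℝ (fromℚ (1/order a)))

{-# OPTIONS --safe #-}

-- Let S be the skew-symmetric ±1 conference matrix of order 4, so S² = -3 and A = i S is the matrix of
-- an orientation of K₄.  Then e^(-itA) = e^(tS) = C(t) + D(t) S with C(t) = cos (√3 t) and
-- D(t) = sin (√3 t) / √3.  At t = π / (3 √3) the triple-angle formula gives
-- 0 = D(3 t) = 3 D(t) (1 - 4 D(t)²), and D(t) ≠ 0 because π is the least positive zero of the sine;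
-- hence D(t)² = 1/4 and C(t)² = 1 - 3 D(t)² = 1/4.  The signs do not matter for mixing.
-- The Kronecker sum of orientations is an orientation of the Cartesian product, and it turns the
-- exponentials into a tensor product, so the squared moduli multiply.
-- Everything rests on Cauchy products of power series with rational coefficients, evaluated at t
-- along the diagonal: the n-th partial sum is taken at the n-th rational approximation of t.

module Submission where

open import Defs
open import Algebra.Bundles using (CommutativeRing)
open import Data.Fin using (Fin; zero; suc; quotient; remainder; combine; _↑ˡ_; _↑ʳ_)
import Data.Fin as Fin
open import Data.Fin.Properties using (nonZeroIndex; remQuot-combine; combine-remQuot; all?)
import Data.Vec.Functional as Vector
open import Data.Bool using (if_then_else_)
open import Data.List using (_∷_; [])
open import Data.Integer using (-[1+_])
import Data.Integer as ℤ
import Data.Integer.Properties as ℤₚ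
open import Data.Nat using (ℕ; _≤_; zero; suc; _⊔_; z≤n; s≤s)
import Data.Nat as ℕ
import Data.Nat.Properties as ℕₚ
open import Data.Product using (Σ-syntax; ∃-syntax; _×_; _,_; proj₁; proj₂)
open import Data.Sum using (_⊎_; inj₁; inj₂)
open import Data.Rational using (ℚ; 0ℚ; 1ℚ; ½; _+_; _*_; _-_; -_; _/_; ∣_∣)
import Data.Rational as ℚ
import Data.Rational.Properties as ℚₚ
open import Data.Rational.Solver using (module +-*-Solver)
open import Data.Rational.Unnormalised using (mkℚᵘ; *≡*; *≤*)
import Data.Rational.Unnormalised as ℚᵘ
import Data.Rational.Unnormalised.Properties as ℚᵘₚ
open import Function using (_∘_)
open import Relation.Binary.PropositionalEquality
open import Relation.Nullary using (¬_; Dec; yes; no; does; contradiction)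
open import Relation.Nullary.Decidable using (from-yes; ¬?; _→-dec_; _⊎-dec_)

open import Algebra.Properties.CommutativeSemiring.Exp
  (CommutativeRing.commutativeSemiring ℚₚ.+-*-commutativeRing) using (_^_; ^-distrib-*; ^-assocʳ)
open import Algebra.Properties.CommutativeMonoid.Sum ℚₚ.+-0-commutativeMonoid using (sum; sum-cong-≗; ∑-distrib-+)
open import Algebra.Properties.Semiring.Sum (CommutativeRing.semiring ℚₚ.+-*-commutativeRing) using (*-distribˡ-sum; *-distribʳ-sum)
open +-*-Solver using (solve; con; _:+_; _:*_; _:-_; :-_; _:=_)

-- Two obstacles shape the argument. The irrational √3 must stay out of the coefficients: since only
-- odd powers of √3 occur in the sine series, it splits off as a single factor, sin (√3 a t) = √3
-- D(a t), and every remaining identity is one between rational power series. Such identities are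
-- proved coefficient by coefficient from linear differential equations with equal constant terms,
-- so that induction and the ring solver do the work, and the same device serves the addition
-- formulas and the Kronecker sums. The second obstacle is constructive. Leastness of π merely
-- refutes D(t) = 0; it gives no lower bound for the absolute value of D(t), so D(t) cannot be
-- inverted in 3 D (1 - 4 D²) = 0 and is cancelled by `null-cancel`. The analysis is confined to one
-- estimate, `cauchy-product`, uniform for arguments in a bounded set. Complex numbers enter only at
-- the end: -it · iS = tS is real, hence so is the exponential.

-- Rational inequalities and the Archimedean property

∣*∣-≤ : ∀ {a b A B} → ∣ a ∣ ℚ.≤ A → ∣ b ∣ ℚ.≤ B → ∣ a * b ∣ ℚ.≤ A * B
∣*∣-≤ {a} {b} {A} {B} a≤A b≤B = begin
  ∣ a * b ∣      ≡⟨ ℚₚ.∣p*q∣≡∣p∣*∣q∣ a b ⟩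
  ∣ a ∣ * ∣ b ∣  ≤⟨ ℚₚ.*-monoʳ-≤-nonNeg ∣ b ∣ {{ℚₚ.∣-∣-nonNeg b}} a≤A ⟩
  A * ∣ b ∣      ≤⟨ ℚₚ.*-monoˡ-≤-nonNeg A {{ℚ.nonNegative (ℚₚ.≤-trans (ℚₚ.0≤∣p∣ a) a≤A)}} b≤B ⟩
  A * B          ∎
  where open ℚₚ.≤-Reasoning

∣+∣-≤ : ∀ {a b A B} → ∣ a ∣ ℚ.≤ A → ∣ b ∣ ℚ.≤ B → ∣ a + b ∣ ℚ.≤ A + B
∣+∣-≤ {a} {b} a≤A b≤B = ℚₚ.≤-trans (ℚₚ.∣p+q∣≤∣p∣+∣q∣ a b) (ℚₚ.+-mono-≤ a≤A b≤B)

∣+∣-< : ∀ {a b A B} → ∣ a ∣ ℚ.< A → ∣ b ∣ ℚ.< B → ∣ a + b ∣ ℚ.< A + B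
∣+∣-< {a} {b} a<A b<B = ℚₚ.≤-<-trans (ℚₚ.∣p+q∣≤∣p∣+∣q∣ a b) (ℚₚ.+-mono-< a<A b<B)

∣∣-sym : ∀ a b → ∣ a - b ∣ ≡ ∣ b - a ∣
∣∣-sym a b = trans (sym (ℚₚ.∣-p∣≡∣p∣ (a - b)))
  (cong ∣_∣ (solve 2 (λ a b → :- (a :- b) := b :- a) refl a b))

*-≤-nonNeg : ∀ {a b c} → 0ℚ ℚ.≤ c → a ℚ.≤ b → c * a ℚ.≤ c * b
*-≤-nonNeg {c = c} 0≤c = ℚₚ.*-monoˡ-≤-nonNeg c {{ℚ.nonNegative 0≤c}}

0<½* : ∀ {ε} → 0ℚ ℚ.< ε → 0ℚ ℚ.< ½ * ε
0<½* {ε} = ℚₚ.*-monoʳ-<-pos ½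

½+½ : ∀ ε → ½ * ε + ½ * ε ≡ ε
½+½ ε = trans (sym (ℚₚ.*-distribʳ-+ ε ½ ½)) (ℚₚ.*-identityˡ ε)

ι : ℕ → ℚ
ι n = ℤ.+ n / 1

toℚᵘ-/ : ∀ i n → ℚ.toℚᵘ (i / suc n) ℚᵘ.≃ mkℚᵘ i n
toℚᵘ-/ i n = ℚₚ.toℚᵘ-fromℚᵘ (mkℚᵘ i n)

ι-suc : ∀ n → ι (suc n) ≡ 1ℚ + ι n
ι-suc n = ℚₚ.toℚᵘ-injective (begin
  ℚ.toℚᵘ (ι (suc n))                ≈⟨ toℚᵘ-/ (ℤ.+ suc n) 0 ⟩
  mkℚᵘ (ℤ.+ suc n) 0                  ≈⟨ *≡* (cong (ℤ._* ℤ.+ 1) (cong (λ k → (ℤ.+ 1) ℤ.+ k) (sym (ℤₚ.*-identityʳ (ℤ.+ n))))) ⟩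
  ℚᵘ.1ℚᵘ ℚᵘ.+ mkℚᵘ (ℤ.+ n) 0          ≈⟨ ℚᵘₚ.+-congʳ ℚᵘ.1ℚᵘ (toℚᵘ-/ (ℤ.+ n) 0) ⟨
  ℚ.toℚᵘ 1ℚ ℚᵘ.+ ℚ.toℚᵘ (ι n)       ≈⟨ ℚₚ.toℚᵘ-homo-+ 1ℚ (ι n) ⟨
  ℚ.toℚᵘ (1ℚ + ι n)                 ∎)
  where open ℚᵘₚ.≃-Reasoning

ι-* : ∀ m n → ι (m ℕ.* n) ≡ ι m * ι n
ι-* zero    n = sym (ℚₚ.*-zeroˡ (ι n))
ι-* (suc m) n = begin
  ι (n ℕ.+ m ℕ.* n)      ≡⟨ ι-+ n (m ℕ.* n) ⟩
  ι n + ι (m ℕ.* n)      ≡⟨ cong (ι n +_) (ι-* m n) ⟩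
  ι n + ι m * ι n        ≡⟨ solve 2 (λ m n → n :+ m :* n := (con 1ℚ :+ m) :* n) refl (ι m) (ι n) ⟩
  (1ℚ + ι m) * ι n       ≡⟨ cong (_* ι n) (ι-suc m) ⟨
  ι (suc m) * ι n        ∎
  where
  open ≡-Reasoning
  ι-+ : ∀ m n → ι (m ℕ.+ n) ≡ ι m + ι n
  ι-+ zero    n = sym (ℚₚ.+-identityˡ (ι n))
  ι-+ (suc m) n = begin
    ι (suc (m ℕ.+ n))     ≡⟨ ι-suc (m ℕ.+ n) ⟩
    1ℚ + ι (m ℕ.+ n)      ≡⟨ cong (1ℚ +_) (ι-+ m n) ⟩
    1ℚ + (ι m + ι n)      ≡⟨ ℚₚ.+-assoc 1ℚ (ι m) (ι n) ⟨
    (1ℚ + ι m) + ι n      ≡⟨ cong (_+ ι n) (ι-suc m) ⟨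
    ι (suc m) + ι n       ∎

1/ι : ∀ n .{{_ : ℕ.NonZero n}} → (ℤ.+ 1 / n) * ι n ≡ 1ℚ
1/ι (suc n) = ℚₚ.toℚᵘ-injective (begin
  ℚ.toℚᵘ ((ℤ.+ 1 / suc n) * ι (suc n))                  ≈⟨ ℚₚ.toℚᵘ-homo-* (ℤ.+ 1 / suc n) (ι (suc n)) ⟩
  ℚ.toℚᵘ (ℤ.+ 1 / suc n) ℚᵘ.* ℚ.toℚᵘ (ι (suc n))        ≈⟨ ℚᵘₚ.*-cong (toℚᵘ-/ (ℤ.+ 1) n) (toℚᵘ-/ (ℤ.+ suc n) 0) ⟩
  mkℚᵘ (ℤ.+ 1) n ℚᵘ.* mkℚᵘ (ℤ.+ suc n) 0                  ≈⟨ *≡* (cong ℤ.+_ (ℕₚ.*-assoc 1 (suc n) 1)) ⟩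
  ℚ.toℚᵘ 1ℚ                                           ∎)
  where open ℚᵘₚ.≃-Reasoning

ι-mono : ∀ {m n} → m ≤ n → ι m ℚ.≤ ι n
ι-mono {m} {n} m≤n = ℚₚ.toℚᵘ-cancel-≤ (begin
  ℚ.toℚᵘ (ι m)  ≃⟨ toℚᵘ-/ (ℤ.+ m) 0 ⟩
  mkℚᵘ (ℤ.+ m) 0  ≤⟨ *≤* (ℤₚ.*-monoʳ-≤-nonNeg (ℤ.+ 1) (ℤ.+≤+ m≤n)) ⟩
  mkℚᵘ (ℤ.+ n) 0  ≃⟨ toℚᵘ-/ (ℤ.+ n) 0 ⟨
  ℚ.toℚᵘ (ι n)  ∎)
  where open ℚᵘₚ.≤-Reasoning

≤ι : ∀ q → ∃[ n ] (q ℚ.≤ ι n)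
≤ι q@(ℚ.mkℚ i d _) = ℤ.∣ i ∣ , ℚₚ.toℚᵘ-cancel-≤ (begin
  mkℚᵘ i d                ≤⟨ *≤* (bound i) ⟩
  mkℚᵘ (ℤ.+ ℤ.∣ i ∣) 0      ≃⟨ toℚᵘ-/ (ℤ.+ ℤ.∣ i ∣) 0 ⟨
  ℚ.toℚᵘ (ι ℤ.∣ i ∣)      ∎)
  where
  open ℚᵘₚ.≤-Reasoning
  bound : ∀ i → i ℤ.* ℤ.+ 1 ℤ.≤ ℤ.+ ℤ.∣ i ∣ ℤ.* ℤ.+ suc d
  bound i = subst₂ ℤ._≤_ (sym (ℤₚ.*-identityʳ i)) (ℤₚ.pos-* ℤ.∣ i ∣ (suc d))
    (ℤₚ.≤-trans (i≤∣i∣ i) (ℤ.+≤+ (ℕₚ.m≤m*n ℤ.∣ i ∣ (suc d))))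
    where
    i≤∣i∣ : ∀ i → i ℤ.≤ ℤ.+ ℤ.∣ i ∣
    i≤∣i∣ (ℤ.+ _)     = ℤₚ.≤-refl
    i≤∣i∣ -[1+ _ ]  = ℤ.-≤+

rescale : ∀ B ε → 0ℚ ℚ.< B → 0ℚ ℚ.< ε → ∃[ δ ] (0ℚ ℚ.< δ × B * δ ≡ ε)
rescale B ε 0<B 0<ε = 1/B * ε
  , subst (ℚ._< 1/B * ε) (ℚₚ.*-zeroʳ 1/B) (ℚₚ.*-monoʳ-<-pos 1/B {{ℚₚ.1/pos⇒pos B}} 0<ε)
  , trans (sym (ℚₚ.*-assoc B 1/B ε))
          (trans (cong (_* ε) (ℚₚ.*-inverseʳ B)) (ℚₚ.*-identityˡ ε))
  where
  instance
    B-pos : ℚ.Positive B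
    B-pos = ℚ.positive 0<B
    B≢0 : ℚ.NonZero B
    B≢0 = ℚₚ.pos⇒nonZero B
  1/B : ℚ
  1/B = ℚ.1/ B

archimedean : ∀ K ε → 0ℚ ℚ.< ε → ∃[ m ] (∀ n → m ≤ n → K ℚ.< ι n * ε)
archimedean K ε 0<ε with ≤ι (K * δ) | δ-inv
  where
  δ = proj₁ (rescale ε 1ℚ 0<ε (ℚₚ.positive⁻¹ 1ℚ))
  δ-inv = proj₂ (proj₂ (rescale ε 1ℚ 0<ε (ℚₚ.positive⁻¹ 1ℚ)))
-- The index `m` only gives `K ≤ ι m * ε`; one more summand `ε` makes the inequality strict.
... | m , Kδ≤ | εδ≡1 = suc m , λ n m<n → begin-strict
  K                       ≡⟨ ℚₚ.*-identityʳ K ⟨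
  K * 1ℚ                  ≡⟨ cong (K *_) εδ≡1 ⟨
  K * (ε * _)             ≡⟨ solve 3 (λ K ε δ → K :* (ε :* δ) := ε :* (K :* δ)) refl K ε _ ⟩
  ε * (K * _)             ≤⟨ *-≤-nonNeg (ℚₚ.<⇒≤ 0<ε) Kδ≤ ⟩
  ε * ι m                 ≡⟨ ℚₚ.+-identityˡ (ε * ι m) ⟨
  0ℚ + ε * ι m            <⟨ ℚₚ.+-monoˡ-< (ε * ι m) 0<ε ⟩
  ε + ε * ι m             ≡⟨ solve 2 (λ ε m → ε :+ ε :* m := ε :* (con 1ℚ :+ m)) refl ε (ι m) ⟩
  ε * (1ℚ + ι m)          ≡⟨ cong (ε *_) (ι-suc m) ⟨
  ε * ι (suc m)           ≤⟨ *-≤-nonNeg (ℚₚ.<⇒≤ 0<ε) (ι-mono m<n) ⟩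
  ε * ι n                 ≡⟨ ℚₚ.*-comm ε (ι n) ⟩
  ι n * ε                 ∎
  where open ℚₚ.≤-Reasoning

-- Null sequences and limits

p≤∣p∣ : ∀ p → p ℚ.≤ ∣ p ∣
p≤∣p∣ p with ℚₚ.≤-total 0ℚ p
... | inj₁ 0≤p = ℚₚ.≤-reflexive (sym (ℚₚ.0≤p⇒∣p∣≡p 0≤p))
... | inj₂ p≤0 = ℚₚ.≤-trans p≤0 (ℚₚ.0≤∣p∣ p)

Null : (ℕ → ℚ) → Set
Null z = ∀ ε → 0ℚ ℚ.< ε → ∃[ N ] (∀ n → N ≤ n → ∣ z n ∣ ℚ.< ε)

infix 4 _≃_
-- `seq x ≃ seq y` is definitionally `x ≈ᴿ y`. Stated for bare sequences, the relation also applies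
-- to diagonals and other sequences that have not been packaged as reals.
_≃_ : (ℕ → ℚ) → (ℕ → ℚ) → Set
x ≃ y = Null (λ n → x n - y n)

null-≗ : ∀ {y z} → (∀ n → y n ≡ z n) → Null y → Null z
null-≗ y≗z null ε 0<ε =
  let N , p = null ε 0<ε in N , λ n N≤n → subst (λ q → ∣ q ∣ ℚ.< ε) (y≗z n) (p n N≤n)

null-0 : Null (λ _ → 0ℚ)
null-0 ε 0<ε = 0 , λ _ _ → 0<ε

null-+ : ∀ {y z} → Null y → Null z → Null (λ n → y n + z n)
null-+ {y} {z} null-y null-z ε 0<ε =
  let M , p = null-y (½ * ε) (0<½* 0<ε)
      N , q = null-z (½ * ε) (0<½* 0<ε)
  in M ⊔ N , λ n ≤n → subst (∣ y n + z n ∣ ℚ.<_) (½+½ ε)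
       (∣+∣-< (p n (ℕₚ.m⊔n≤o⇒m≤o M N ≤n)) (q n (ℕₚ.m⊔n≤o⇒n≤o M N ≤n)))

null-neg : ∀ {z} → Null z → Null (λ n → - z n)
null-neg {z} null ε 0<ε =
  let N , p = null ε 0<ε in N , λ n N≤n → subst (ℚ._< ε) (sym (ℚₚ.∣-p∣≡∣p∣ (z n))) (p n N≤n)

null-≤ : ∀ {y z} N → (∀ n → N ≤ n → ∣ y n ∣ ℚ.≤ z n) → Null z → Null y
null-≤ N y≤z null ε 0<ε =
  let M , p = null ε 0<ε
  in M ⊔ N , λ n ≤n → ℚₚ.≤-<-trans (y≤z n (ℕₚ.m⊔n≤o⇒n≤o M N ≤n))
       (ℚₚ.≤-<-trans (p≤∣p∣ _) (p n (ℕₚ.m⊔n≤o⇒m≤o M N ≤n)))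

null-scale : ∀ B {z} → 0ℚ ℚ.< B → Null z → Null (λ n → B * z n)
null-scale B {z} 0<B null ε 0<ε =
  let δ , 0<δ , Bδ≡ε = rescale B ε 0<B 0<ε
      N , p = null δ 0<δ
  in N , λ n N≤n → begin-strict
    ∣ B * z n ∣      ≡⟨ ℚₚ.∣p*q∣≡∣p∣*∣q∣ B (z n) ⟩
    ∣ B ∣ * ∣ z n ∣  ≡⟨ cong (_* ∣ z n ∣) (ℚₚ.0≤p⇒∣p∣≡p (ℚₚ.<⇒≤ 0<B)) ⟩
    B * ∣ z n ∣      <⟨ ℚₚ.*-monoʳ-<-pos B {{ℚ.positive 0<B}} (p n N≤n) ⟩
    B * δ            ≡⟨ Bδ≡ε ⟩
    ε                ∎
  where open ℚₚ.≤-Reasoning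

null-∣∣ : ∀ {z} → Null z → Null (λ n → ∣ z n ∣)
null-∣∣ {z} null ε 0<ε =
  let N , p = null ε 0<ε in N , λ n N≤n → subst (ℚ._< ε) (sym (ℚₚ.∣∣p∣∣≡∣p∣ (z n))) (p n N≤n)

-- The factor is a real because its eventual bound comes from being Cauchy. This is why diagonals
-- that multiply a null sequence are first wrapped by `eval`.
null-* : ∀ x {z} → Null z → Null (λ n → seq x n * z n)
null-* x {z} null =
  let B , 0<B , N , x≤B = cauchy⇒bounded (seq x) (cauchy x)
  in null-≤ N (λ n N≤n → ∣*∣-≤ (x≤B n N≤n) ℚₚ.≤-refl) (null-scale B 0<B (null-∣∣ null))

null-const : ∀ q → Null (λ _ → q) → q ≡ 0ℚ
null-const q null with q ℚ.≟ 0ℚ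
... | yes q≡0 = q≡0
... | no  q≢0 = contradiction (p N ℕₚ.≤-refl) (ℚₚ.<-irrefl refl)
  where
  0<∣q∣ : 0ℚ ℚ.< ∣ q ∣
  0<∣q∣ = ℚₚ.≰⇒> λ ∣q∣≤0 → q≢0 (ℚₚ.∣p∣≡0⇒p≡0 q (ℚₚ.≤-antisym ∣q∣≤0 (ℚₚ.0≤∣p∣ q)))
  N = proj₁ (null ∣ q ∣ 0<∣q∣)
  p = proj₂ (null ∣ q ∣ 0<∣q∣)

≃-reflexive : ∀ {x y} → (∀ n → x n ≡ y n) → x ≃ y
≃-reflexive {x} {y} x≗y = null-≗ (λ n →
  sym (trans (cong (λ q → x n - q) (sym (x≗y n))) (ℚₚ.+-inverseʳ (x n)))) null-0

≃-sym : ∀ {x y} → x ≃ y → y ≃ x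
≃-sym {x} {y} x≃y = null-≗ (λ n →
  solve 2 (λ x y → :- (x :- y) := y :- x) refl (x n) (y n)) (null-neg x≃y)

≃-trans : ∀ {x y z} → x ≃ y → y ≃ z → x ≃ z
≃-trans {x} {y} {z} x≃y y≃z = null-≗ (λ n →
  solve 3 (λ x y z → (x :- y) :+ (y :- z) := x :- z) refl (x n) (y n) (z n)) (null-+ x≃y y≃z)

*ᴿ-cong : ∀ {x x′ y y′} → x ≈ᴿ x′ → y ≈ᴿ y′ → x *ᴿ y ≈ᴿ x′ *ᴿ y′
*ᴿ-cong {x} {x′} {y} {y′} x≈x′ y≈y′ = null-≗ (λ n →
  solve 4 (λ x x′ y y′ → x :* (y :- y′) :+ y′ :* (x :- x′) := x :* y :- x′ :* y′) refl
    (seq x n) (seq x′ n) (seq y n) (seq y′ n)) (null-+ (null-* x y≈y′) (null-* y′ x≈x′))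

*ᴿ-congˡ : ∀ x {y y′} → y ≈ᴿ y′ → x *ᴿ y ≈ᴿ x *ᴿ y′
*ᴿ-congˡ x {y} {y′} = *ᴿ-cong {x} {x} {y} {y′} (≃-reflexive {seq x} (λ _ → refl))

^ᴿ-cong : ∀ {x y} → x ≈ᴿ y → ∀ k → x ^ᴿ k ≈ᴿ y ^ᴿ k
^ᴿ-cong x≈y zero = ≃-reflexive {λ _ → 1ℚ} (λ _ → refl)
^ᴿ-cong {x} {y} x≈y (suc k) = *ᴿ-cong {x} {y} {x ^ᴿ k} {y ^ᴿ k} x≈y (^ᴿ-cong {x} {y} x≈y k)

seq-^ : ∀ x k n → seq (x ^ᴿ k) n ≡ seq x n ^ k
seq-^ x zero    n = refl
seq-^ x (suc k) n = cong (seq x n *_) (seq-^ x k n)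

-- Whether a late enough term of y shows y to be apart from 0 is decidable; if it does, x is null.
null-cancel : ∀ x y → Null (λ n → seq x n * seq y n) → ¬ Null (seq x) → Null (seq y)
null-cancel x y null-xy ¬null-x ε 0<ε = cases
  where
  open ℚₚ.≤-Reasoning
  -- Four `η` make `ε`. From index `N` on, `y` moves by less than `η`: if its `N`-th term is below
  -- `2 η`, all later terms stay below `3 η`; otherwise they all stay at least `η` away from 0.
  η : ℚ
  η = ½ * (½ * ε)
  0<η : 0ℚ ℚ.< η
  0<η = 0<½* (0<½* 0<ε)
  N = proj₁ (cauchy y η 0<η)
  near = proj₂ (cauchy y η 0<η)

  apart⇒null : ¬ ∣ seq y N ∣ ℚ.< η + η → Null (seq x)
  apart⇒null yN≮2η δ 0<δ =
    let 0<ηδ = subst (ℚ._< η * δ) (ℚₚ.*-zeroʳ η) (ℚₚ.*-monoʳ-<-pos η {{ℚ.positive 0<η}} 0<δ)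
        M , p = null-xy (η * δ) 0<ηδ
    in N ⊔ M , λ n ≤n → ℚₚ.≰⇒> λ δ≤xn → ℚₚ.<-irrefl refl (begin-strict
      η * δ                    ≤⟨ *-≤-nonNeg (ℚₚ.<⇒≤ 0<η) δ≤xn ⟩
      η * ∣ seq x n ∣          ≤⟨ ℚₚ.*-monoʳ-≤-nonNeg ∣ seq x n ∣ {{ℚₚ.∣-∣-nonNeg (seq x n)}}
                                    (η≤y n (ℕₚ.m⊔n≤o⇒m≤o N M ≤n)) ⟩
      ∣ seq y n ∣ * ∣ seq x n ∣  ≡⟨ ℚₚ.*-comm ∣ seq y n ∣ ∣ seq x n ∣ ⟩
      ∣ seq x n ∣ * ∣ seq y n ∣  ≡⟨ ℚₚ.∣p*q∣≡∣p∣*∣q∣ (seq x n) (seq y n) ⟨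
      ∣ seq x n * seq y n ∣    <⟨ p n (ℕₚ.m⊔n≤o⇒n≤o N M ≤n) ⟩
      η * δ                    ∎)
    where
    η≤y : ∀ n → N ≤ n → η ℚ.≤ ∣ seq y n ∣
    η≤y n N≤n = ℚₚ.≮⇒≥ λ yn<η → yN≮2η (subst (ℚ._< η + η)
      (cong ∣_∣ (solve 2 (λ a b → (a :- b) :+ b := a) refl (seq y N) (seq y n)))
      (∣+∣-< (near N n ℕₚ.≤-refl N≤n) yn<η))

  cases : ∃[ M ] (∀ n → M ≤ n → ∣ seq y n ∣ ℚ.< ε)
  cases with ∣ seq y N ∣ ℚ.<? η + η
  ... | no  yN≮2η = contradiction (apart⇒null yN≮2η) ¬null-x
  ... | yes yN<2η = N , λ n N≤n → begin-strict
    ∣ seq y n ∣                        ≡⟨ cong ∣_∣ (solve 2 (λ a b → a := (a :- b) :+ b) refl (seq y n) (seq y N)) ⟩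
    ∣ (seq y n - seq y N) + seq y N ∣  <⟨ ∣+∣-< (near n N N≤n ℕₚ.≤-refl) yN<2η ⟩
    η + (η + η)                        ≡⟨ ℚₚ.+-identityʳ _ ⟨
    η + (η + η) + 0ℚ                   <⟨ ℚₚ.+-monoʳ-< (η + (η + η)) 0<η ⟩
    η + (η + η) + η                    ≡⟨ solve 1 (λ h → h :+ (h :+ h) :+ h := (h :+ h) :+ (h :+ h)) refl η ⟩
    (η + η) + (η + η)                  ≡⟨ cong₂ _+_ (½+½ (½ * ε)) (½+½ (½ * ε)) ⟩
    ½ * ε + ½ * ε                      ≡⟨ ½+½ ε ⟩
    ε                                  ∎

-- Limits of sequences of reals

-- A form of `_⟶_` with absolute values in place of two strict inequalities between reals. The inner
-- threshold may depend on `m`, and the limit is a bare sequence, so that a diagonal can be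
-- recognised as a limit before it is known to be Cauchy.
Tends : (ℕ → ℝ) → (ℕ → ℚ) → Set
Tends f L = ∀ ε → 0ℚ ℚ.< ε → ∃[ M ] (∀ m → M ≤ m →
  ∃[ N ] (∀ n → N ≤ n → ∣ seq (f m) n - L n ∣ ℚ.< ε))

-- `_<ᴿ_` asks for a positive rational gap. Approximating to within `½ * ε` leaves the other half of
-- `ε` as that gap.
tends⇒⟶ : ∀ {f} L → Tends f (seq L) → f ⟶ L
tends⇒⟶ {f} L tends ε 0<ε =
  let M , p = tends (½ * ε) (0<½* 0<ε)
  in M , λ m M≤m → let N , q = p m M≤m in
    (½ * ε , 0<½* 0<ε , N , λ n N≤n → gap (q n N≤n)) ,
    (½ * ε , 0<½* 0<ε , N , λ n N≤n →
      gap (subst (ℚ._< ½ * ε) (∣∣-sym (seq (f m) n) (seq L n)) (q n N≤n)))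
  where
  open ℚₚ.≤-Reasoning
  gap : ∀ {a} → ∣ a ∣ ℚ.< ½ * ε → ½ * ε ℚ.< ε - a
  gap {a} a<½ε = begin-strict
    ½ * ε                  ≡⟨ solve 2 (λ h a → h := h :+ a :- a) refl (½ * ε) a ⟩
    ½ * ε + a - a          <⟨ ℚₚ.+-monoˡ-< (- a) (ℚₚ.+-monoʳ-< (½ * ε) (ℚₚ.≤-<-trans (p≤∣p∣ a) a<½ε)) ⟩
    ½ * ε + ½ * ε - a      ≡⟨ cong (_- a) (½+½ ε) ⟩
    ε - a                  ∎

⟶⇒tends : ∀ {f} L → f ⟶ L → Tends f (seq L)
⟶⇒tends {f} L lim ε 0<ε =
  let M , p = lim ε 0<ε
  in M , λ m M≤m → let (δ , 0<δ , N , q) , (δ′ , 0<δ′ , N′ , q′) = p m M≤m in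
    N ⊔ N′ , λ n ≤n →
      close (ungap 0<δ (q n (ℕₚ.m⊔n≤o⇒m≤o N N′ ≤n)))
        (subst (ℚ._< ε) (solve 2 (λ a b → b :- a := :- (a :- b)) refl (seq (f m) n) (seq L n))
          (ungap 0<δ′ (q′ n (ℕₚ.m⊔n≤o⇒n≤o N N′ ≤n))))
  where
  open ℚₚ.≤-Reasoning
  ungap : ∀ {a δ} → 0ℚ ℚ.< δ → δ ℚ.< ε - a → a ℚ.< ε
  ungap {a} {δ} 0<δ δ<ε-a = begin-strict
    a             ≡⟨ ℚₚ.+-identityˡ a ⟨
    0ℚ + a        <⟨ ℚₚ.+-monoˡ-< a (ℚₚ.<-trans 0<δ δ<ε-a) ⟩
    ε - a + a     ≡⟨ solve 2 (λ e a → e :- a :+ a := e) refl ε a ⟩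
    ε             ∎
  close : ∀ {a} → a ℚ.< ε → - a ℚ.< ε → ∣ a ∣ ℚ.< ε
  close {a} a<ε -a<ε with ℚₚ.∣p∣≡p∨∣p∣≡-p a
  ... | inj₁ ∣a∣≡a  = subst (ℚ._< ε) (sym ∣a∣≡a) a<ε
  ... | inj₂ ∣a∣≡-a = subst (ℚ._< ε) (sym ∣a∣≡-a) -a<ε

tends-unique : ∀ {f L L′} → Tends f L → Tends f L′ → L ≃ L′
tends-unique {f} {L} {L′} p q ε 0<ε =
  let M , p₁ = p (½ * ε) (0<½* 0<ε)
      M′ , q₁ = q (½ * ε) (0<½* 0<ε)
      m = M ⊔ M′
      N , p₂ = p₁ m (ℕₚ.m≤m⊔n M M′)
      N′ , q₂ = q₁ m (ℕₚ.m≤n⊔m M M′)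
  in N ⊔ N′ , λ n ≤n → subst₂ ℚ._<_
    (cong ∣_∣ (solve 3 (λ f a b → (a :- f) :+ (f :- b) := a :- b) refl (seq (f m) n) (L n) (L′ n)))
    (½+½ ε)
    (∣+∣-< (subst (ℚ._< ½ * ε) (∣∣-sym (seq (f m) n) (L n)) (p₂ n (ℕₚ.m⊔n≤o⇒m≤o N N′ ≤n)))
           (q₂ n (ℕₚ.m⊔n≤o⇒n≤o N N′ ≤n)))

tends-resp : ∀ {f g L L′} → (∀ m → f m ≈ᴿ g m) → L ≃ L′ → Tends f L → Tends g L′
tends-resp {f} {g} {L} {L′} f≈g L≃L′ tends ε 0<ε =
  let η = ½ * (½ * ε)
      0<η = 0<½* (0<½* 0<ε)
      M , p = tends (½ * ε) (0<½* 0<ε)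
      K , l = L≃L′ η 0<η
  in M , λ m M≤m →
    let N , q = p m M≤m
        N′ , r = f≈g m η 0<η
        k = K ⊔ N′
    in k ⊔ N , λ n ≤n →
      let k≤n = ℕₚ.m⊔n≤o⇒m≤o k N ≤n in
      subst₂ ℚ._<_
        (cong ∣_∣ (solve 4 (λ f g a b → (a :- b) :+ (g :- f) :+ (f :- a) := g :- b) refl
           (seq (f m) n) (seq (g m) n) (L n) (L′ n)))
        (trans (cong (_+ ½ * ε) (½+½ (½ * ε))) (½+½ ε))
        (∣+∣-< (∣+∣-< (l n (ℕₚ.m⊔n≤o⇒m≤o K N′ k≤n))
                      (subst (ℚ._< η) (∣∣-sym (seq (f m) n) (seq (g m) n))
                        (r n (ℕₚ.m⊔n≤o⇒n≤o K N′ k≤n))))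
               (q n (ℕₚ.m⊔n≤o⇒n≤o k N ≤n)))

tends-scale : ∀ x {f L} → Tends f L → Tends (λ m → x *ᴿ f m) (λ n → seq x n * L n)
tends-scale x {f} {L} tends ε 0<ε =
  let B , 0<B , K , x≤B = cauchy⇒bounded (seq x) (cauchy x)
      δ , 0<δ , Bδ≡ε = rescale B ε 0<B 0<ε
      M , p = tends δ 0<δ
  in M , λ m M≤m → let N , q = p m M≤m in
    K ⊔ N , λ n ≤n → begin-strict
      ∣ seq x n * seq (f m) n - seq x n * L n ∣
        ≡⟨ cong ∣_∣ (solve 3 (λ x a b → x :* a :- x :* b := x :* (a :- b)) refl (seq x n) (seq (f m) n) (L n)) ⟩
      ∣ seq x n * (seq (f m) n - L n) ∣
        ≤⟨ ∣*∣-≤ (x≤B n (ℕₚ.m⊔n≤o⇒m≤o K N ≤n)) ℚₚ.≤-refl ⟩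
      B * ∣ seq (f m) n - L n ∣
        <⟨ ℚₚ.*-monoʳ-<-pos B {{ℚ.positive 0<B}} (q n (ℕₚ.m⊔n≤o⇒n≤o K N ≤n)) ⟩
      B * δ
        ≡⟨ Bδ≡ε ⟩
      ε ∎
  where open ℚₚ.≤-Reasoning

tends-subsequence : ∀ {f L} (s : ℕ → ℕ) → (∀ m → m ≤ s m) → Tends f L → Tends (f ∘ s) L
tends-subsequence s m≤sm tends ε 0<ε =
  let M , p = tends ε 0<ε in M , λ m M≤m → p (s m) (ℕₚ.≤-trans M≤m (m≤sm m))

-- A single far term suffices: `L` is eventually close to the sequence of `f M`, which is Cauchy.
tends-cauchy : ∀ {f L} → Tends f L → IsCauchy L
tends-cauchy {f} {L} tends ε 0<ε =
  let η = ½ * (½ * ε)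
      0<η = 0<½* (0<½* 0<ε)
      M , p = tends η 0<η
      N , q = p M ℕₚ.≤-refl
      N′ , r = cauchy (f M) (½ * ε) (0<½* 0<ε)
  in N ⊔ N′ , λ m n ≤m ≤n → subst₂ ℚ._<_
    (cong ∣_∣ (solve 4 (λ a b f g → (a :- f) :+ (g :- b) :+ (f :- g) := a :- b) refl
       (L m) (L n) (seq (f M) m) (seq (f M) n)))
    (trans (cong (_+ ½ * ε) (½+½ (½ * ε))) (½+½ ε))
    (∣+∣-< (∣+∣-< (subst (ℚ._< η) (∣∣-sym (seq (f M) m) (L m)) (q m (ℕₚ.m⊔n≤o⇒m≤o N N′ ≤m)))
                  (q n (ℕₚ.m⊔n≤o⇒m≤o N N′ ≤n)))
           (r m n (ℕₚ.m⊔n≤o⇒n≤o N N′ ≤m) (ℕₚ.m⊔n≤o⇒n≤o N N′ ≤n)))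

-- Geometric decay

0≤^ : ∀ {x} → 0ℚ ℚ.≤ x → ∀ n → 0ℚ ℚ.≤ x ^ n
0≤^ 0≤x zero    = ℚ.*≤* (ℤ.+≤+ z≤n)
0≤^ {x} 0≤x (suc n) = subst (ℚ._≤ x * x ^ n) (ℚₚ.*-zeroʳ x) (*-≤-nonNeg 0≤x (0≤^ 0≤x n))

0≤½ : 0ℚ ℚ.≤ ½
0≤½ = ℚ.*≤* (ℤ.+≤+ z≤n)

½^≤1 : ∀ n → ½ ^ n ℚ.≤ 1ℚ
½^≤1 zero    = ℚₚ.≤-refl
½^≤1 (suc n) = ℚₚ.≤-trans (*-≤-nonNeg 0≤½ (½^≤1 n)) (ℚ.*≤* (ℤ.+≤+ (s≤s z≤n)))

0<½^ : ∀ n → 0ℚ ℚ.< ½ ^ n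
0<½^ zero    = ℚₚ.positive⁻¹ 1ℚ
0<½^ (suc n) = 0<½* (0<½^ n)

-- A crude bound of `½ ^ n` by 1 / n, which reduces the decay of powers of ½ to the Archimedean
-- property.
ι*½^≤1 : ∀ n → ι n * ½ ^ n ℚ.≤ 1ℚ
ι*½^≤1 zero    = ℚ.*≤* (ℤ.+≤+ z≤n)
ι*½^≤1 (suc n) = begin
  ι (suc n) * (½ * ½ ^ n)             ≡⟨ cong (_* (½ * ½ ^ n)) (ι-suc n) ⟩
  (1ℚ + ι n) * (½ * ½ ^ n)            ≡⟨ solve 3 (λ i h p → (con 1ℚ :+ i) :* (h :* p) := h :* p :+ h :* (i :* p)) refl (ι n) ½ (½ ^ n) ⟩
  ½ * ½ ^ n + ½ * (ι n * ½ ^ n)       ≤⟨ ℚₚ.+-mono-≤ (*-≤-nonNeg 0≤½ (½^≤1 n)) (*-≤-nonNeg 0≤½ (ι*½^≤1 n)) ⟩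
  ½ * 1ℚ + ½ * 1ℚ                     ≡⟨ ½+½ 1ℚ ⟩
  1ℚ                                  ∎
  where open ℚₚ.≤-Reasoning

null-½^ : ∀ K → Null (λ n → K * ½ ^ n)
null-½^ K ε 0<ε =
  let m , p = archimedean ∣ K ∣ ε 0<ε
  in m , λ n m≤n → begin-strict
    ∣ K * ½ ^ n ∣          ≡⟨ ℚₚ.∣p*q∣≡∣p∣*∣q∣ K (½ ^ n) ⟩
    ∣ K ∣ * ∣ ½ ^ n ∣      ≡⟨ cong (∣ K ∣ *_) (ℚₚ.0≤p⇒∣p∣≡p (ℚₚ.<⇒≤ (0<½^ n))) ⟩
    ∣ K ∣ * ½ ^ n          <⟨ ℚₚ.*-monoˡ-<-pos (½ ^ n) {{ℚ.positive (0<½^ n)}} (p n m≤n) ⟩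
    ι n * ε * ½ ^ n        ≡⟨ solve 3 (λ i e p → i :* e :* p := e :* (i :* p)) refl (ι n) ε (½ ^ n) ⟩
    ε * (ι n * ½ ^ n)      ≤⟨ *-≤-nonNeg (ℚₚ.<⇒≤ 0<ε) (ι*½^≤1 n) ⟩
    ε * 1ℚ                 ≡⟨ ℚₚ.*-identityʳ ε ⟩
    ε                      ∎
  where open ℚₚ.≤-Reasoning

-- Power series with rational coefficients

Σ< : (ℕ → ℚ) → ℕ → ℚ
Σ< = partialSum 0ℚ _+_

Σ<-cong : ∀ {u v} → (∀ k → u k ≡ v k) → ∀ n → Σ< u n ≡ Σ< v n
Σ<-cong u≗v zero    = refl
Σ<-cong u≗v (suc n) = cong₂ _+_ (Σ<-cong u≗v n) (u≗v n)

Σ<-+ : ∀ u v n → Σ< (λ k → u k + v k) n ≡ Σ< u n + Σ< v n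
Σ<-+ u v zero    = refl
Σ<-+ u v (suc n) = trans (cong (_+ (u n + v n)) (Σ<-+ u v n))
  (solve 4 (λ a b c d → (a :+ b) :+ (c :+ d) := (a :+ c) :+ (b :+ d)) refl
    (Σ< u n) (Σ< v n) (u n) (v n))

Σ<-scale : ∀ c u n → Σ< (λ k → c * u k) n ≡ c * Σ< u n
Σ<-scale c u zero    = sym (ℚₚ.*-zeroʳ c)
Σ<-scale c u (suc n) = trans (cong (_+ c * u n) (Σ<-scale c u n)) (sym (ℚₚ.*-distribˡ-+ c (Σ< u n) (u n)))

Σ<-head : ∀ u n → Σ< u (suc n) ≡ u 0 + Σ< (u ∘ suc) n
Σ<-head u zero    = ℚₚ.+-comm 0ℚ (u 0)
Σ<-head u (suc n) = trans (cong (_+ u (suc n)) (Σ<-head u n)) (ℚₚ.+-assoc (u 0) (Σ< (u ∘ suc) n) (u (suc n)))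

-- The subtracted `½ ^ n` makes the induction close: `K * ½ ^ n` is exactly the drop of
-- `(K + K) * ½ ^ n` from one index to the next, so the bound telescopes. `Σ<-tail′` then discards
-- it.
Σ<-tail : ∀ u K {m n} → (∀ k → ∣ u k ∣ ℚ.≤ K * ½ ^ k) → m ≤ n →
          ∣ Σ< u n - Σ< u m ∣ ℚ.≤ (K + K) * (½ ^ m - ½ ^ n)
Σ<-tail u K {m} u≤ m≤n = go (ℕₚ.≤⇒≤′ m≤n)
  where
  open ℚₚ.≤-Reasoning
  go : ∀ {n} → m ℕ.≤′ n → ∣ Σ< u n - Σ< u m ∣ ℚ.≤ (K + K) * (½ ^ m - ½ ^ n)
  go (ℕ.≤′-reflexive refl) = ℚₚ.≤-reflexive (trans (cong ∣_∣ (ℚₚ.+-inverseʳ (Σ< u m)))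
    (sym (trans (cong ((K + K) *_) (ℚₚ.+-inverseʳ (½ ^ m))) (ℚₚ.*-zeroʳ (K + K)))))
  go {suc n} (ℕ.≤′-step m≤n) = begin
    ∣ Σ< u n + u n - Σ< u m ∣
      ≡⟨ cong ∣_∣ (solve 3 (λ a b c → a :+ b :- c := a :- c :+ b) refl (Σ< u n) (u n) (Σ< u m)) ⟩
    ∣ (Σ< u n - Σ< u m) + u n ∣
      ≤⟨ ∣+∣-≤ (go m≤n) (u≤ n) ⟩
    (K + K) * (½ ^ m - ½ ^ n) + K * ½ ^ n
      ≡⟨ cong (λ p → (K + K) * (½ ^ m - p) + K * p) (½+½ (½ ^ n)) ⟨
    (K + K) * (½ ^ m - (½ ^ suc n + ½ ^ suc n)) + K * (½ ^ suc n + ½ ^ suc n)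
      ≡⟨ solve 3 (λ k p q → (k :+ k) :* (p :- (q :+ q)) :+ k :* (q :+ q) := (k :+ k) :* (p :- q)) refl
           K (½ ^ m) (½ ^ suc n) ⟩
    (K + K) * (½ ^ m - ½ ^ suc n) ∎

-- The bound at index 0 reads `∣ u 0 ∣ ≤ K`, so geometric bounds carry the sign of their constant
-- with them.
bound⇒0≤K : ∀ (u : ℕ → ℚ) K r → (∀ k → ∣ u k ∣ ℚ.≤ K * r ^ k) → 0ℚ ℚ.≤ K
bound⇒0≤K u K r u≤ = subst (0ℚ ℚ.≤_) (ℚₚ.*-identityʳ K) (ℚₚ.≤-trans (ℚₚ.0≤∣p∣ (u 0)) (u≤ 0))

Σ<-tail′ : ∀ u K {m n} → (∀ k → ∣ u k ∣ ℚ.≤ K * ½ ^ k) → m ≤ n →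
           ∣ Σ< u n - Σ< u m ∣ ℚ.≤ (K + K) * ½ ^ m
Σ<-tail′ u K {m} {n} u≤ m≤n = ℚₚ.≤-trans (Σ<-tail u K u≤ m≤n)
  (*-≤-nonNeg (ℚₚ.+-mono-≤ 0≤K 0≤K) (begin
    ½ ^ m - ½ ^ n       ≤⟨ ℚₚ.+-monoʳ-≤ (½ ^ m) (ℚₚ.neg-antimono-≤ (ℚₚ.<⇒≤ (0<½^ n))) ⟩
    ½ ^ m - 0ℚ          ≡⟨ ℚₚ.+-identityʳ (½ ^ m) ⟩
    ½ ^ m               ∎))
  where
  open ℚₚ.≤-Reasoning
  0≤K = bound⇒0≤K u K ½ u≤

¼ : ℚ
¼ = ℤ.+ 1 / 4

¼^≤½^ : ∀ k → ¼ ^ k ℚ.≤ ½ ^ k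
¼^≤½^ k = begin
  (½ * ½) ^ k      ≡⟨ ^-distrib-* ½ ½ k ⟩
  ½ ^ k * ½ ^ k    ≤⟨ *-≤-nonNeg (ℚₚ.<⇒≤ (0<½^ k)) (½^≤1 k) ⟩
  ½ ^ k * 1ℚ       ≡⟨ ℚₚ.*-identityʳ (½ ^ k) ⟩
  ½ ^ k            ∎
  where open ℚₚ.≤-Reasoning

¼-bound⇒½-bound : ∀ (u : ℕ → ℚ) K → (∀ k → ∣ u k ∣ ℚ.≤ K * ¼ ^ k) → ∀ k → ∣ u k ∣ ℚ.≤ K * ½ ^ k
¼-bound⇒½-bound u K u≤ k = ℚₚ.≤-trans (u≤ k) (*-≤-nonNeg (bound⇒0≤K u K ¼ u≤) (¼^≤½^ k))

-- Cauchy products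

-- Coefficients of the product of two series, peeled from the left: writing u = u₀ + X u′ gives u v
-- = u₀ v + X (u′ v). Inductions on the index therefore generalise over `u` and pass to its shift.
conv : (ℕ → ℚ) → (ℕ → ℚ) → ℕ → ℚ
conv u v zero    = u 0 * v 0
conv u v (suc k) = u 0 * v (suc k) + conv (u ∘ suc) v k

conv-cong : ∀ {u u′ v v′} → (∀ k → u k ≡ u′ k) → (∀ k → v k ≡ v′ k) → ∀ k → conv u v k ≡ conv u′ v′ k
conv-cong u≗u′ v≗v′ zero    = cong₂ _*_ (u≗u′ 0) (v≗v′ 0)
conv-cong u≗u′ v≗v′ (suc k) =
  cong₂ _+_ (cong₂ _*_ (u≗u′ 0) (v≗v′ (suc k))) (conv-cong (u≗u′ ∘ suc) v≗v′ k)

conv-+ˡ : ∀ u u′ v k → conv (λ i → u i + u′ i) v k ≡ conv u v k + conv u′ v k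
conv-+ˡ u u′ v zero    = ℚₚ.*-distribʳ-+ (v 0) (u 0) (u′ 0)
conv-+ˡ u u′ v (suc k) = trans (cong ((u 0 + u′ 0) * v (suc k) +_) (conv-+ˡ (u ∘ suc) (u′ ∘ suc) v k))
  (solve 5 (λ a b c d e → (a :+ b) :* c :+ (d :+ e) := a :* c :+ d :+ (b :* c :+ e)) refl
    (u 0) (u′ 0) (v (suc k)) (conv (u ∘ suc) v k) (conv (u′ ∘ suc) v k))

conv-+ʳ : ∀ u v v′ k → conv u (λ i → v i + v′ i) k ≡ conv u v k + conv u v′ k
conv-+ʳ u v v′ zero    = ℚₚ.*-distribˡ-+ (u 0) (v 0) (v′ 0)
conv-+ʳ u v v′ (suc k) = trans (cong (u 0 * (v (suc k) + v′ (suc k)) +_) (conv-+ʳ (u ∘ suc) v v′ k))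
  (solve 5 (λ a b c d e → a :* (b :+ c) :+ (d :+ e) := a :* b :+ d :+ (a :* c :+ e)) refl
    (u 0) (v (suc k)) (v′ (suc k)) (conv (u ∘ suc) v k) (conv (u ∘ suc) v′ k))

conv-scaleˡ : ∀ c u v k → conv (λ i → c * u i) v k ≡ c * conv u v k
conv-scaleˡ c u v zero    = ℚₚ.*-assoc c (u 0) (v 0)
conv-scaleˡ c u v (suc k) = trans (cong (c * u 0 * v (suc k) +_) (conv-scaleˡ c (u ∘ suc) v k))
  (solve 4 (λ c a b d → c :* a :* b :+ c :* d := c :* (a :* b :+ d)) refl
    c (u 0) (v (suc k)) (conv (u ∘ suc) v k))

conv-scaleʳ : ∀ c u v k → conv u (λ i → c * v i) k ≡ c * conv u v k
conv-scaleʳ c u v zero    = solve 3 (λ a c b → a :* (c :* b) := c :* (a :* b)) refl (u 0) c (v 0)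
conv-scaleʳ c u v (suc k) = trans (cong (u 0 * (c * v (suc k)) +_) (conv-scaleʳ c (u ∘ suc) v k))
  (solve 4 (λ c a b d → a :* (c :* b) :+ c :* d := c :* (a :* b :+ d)) refl
    c (u 0) (v (suc k)) (conv (u ∘ suc) v k))

conv-^ : ∀ f g x k → conv (λ i → f i * x ^ i) (λ i → g i * x ^ i) k ≡ conv f g k * x ^ k
conv-^ f g x zero    = solve 2 (λ a b → a :* con 1ℚ :* (b :* con 1ℚ) := a :* b :* con 1ℚ) refl (f 0) (g 0)
conv-^ f g x (suc k) = begin
  f 0 * 1ℚ * (g (suc k) * x ^ suc k) + conv (λ i → f (suc i) * (x * x ^ i)) (λ i → g i * x ^ i) k
    ≡⟨ cong (f 0 * 1ℚ * (g (suc k) * x ^ suc k) +_) (begin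
      conv (λ i → f (suc i) * (x * x ^ i)) gₓ k   ≡⟨ conv-cong {v = gₓ} (λ i → solve 3 (λ f x p → f :* (x :* p) := x :* (f :* p)) refl (f (suc i)) x (x ^ i)) (λ _ → refl) k ⟩
      conv (λ i → x * (f (suc i) * x ^ i)) gₓ k   ≡⟨ conv-scaleˡ x (λ i → f (suc i) * x ^ i) gₓ k ⟩
      x * conv (λ i → f (suc i) * x ^ i) gₓ k     ≡⟨ cong (x *_) (conv-^ (f ∘ suc) g x k) ⟩
      x * (conv (f ∘ suc) g k * x ^ k)            ∎) ⟩
  f 0 * 1ℚ * (g (suc k) * x ^ suc k) + x * (conv (f ∘ suc) g k * x ^ k)
    ≡⟨ solve 5 (λ a b x p c → a :* con 1ℚ :* (b :* (x :* p)) :+ x :* (c :* p) := (a :* b :+ c) :* (x :* p)) refl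
         (f 0) (g (suc k)) x (x ^ k) (conv (f ∘ suc) g k) ⟩
  (f 0 * g (suc k) + conv (f ∘ suc) g k) * x ^ suc k ∎
  where
  open ≡-Reasoning
  gₓ : ℕ → ℚ
  gₓ i = g i * x ^ i

Σ<-conv : ∀ u v n → Σ< (conv u v) (suc n) ≡ u 0 * Σ< v (suc n) + Σ< (conv (u ∘ suc) v) n
Σ<-conv u v zero    = solve 2 (λ a b → con 0ℚ :+ a :* b := a :* (con 0ℚ :+ b) :+ con 0ℚ) refl (u 0) (v 0)
Σ<-conv u v (suc n) = trans (cong (_+ conv u v (suc n)) (Σ<-conv u v n))
  (solve 5 (λ a V S b c → a :* V :+ S :+ (a :* b :+ c) := a :* (V :+ b) :+ (S :+ c)) refl
    (u 0) (Σ< v (suc n)) (Σ< (conv (u ∘ suc) v) n) (v (suc n)) (conv (u ∘ suc) v n))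

-- Passing to the shifted `u′`, the error at `suc n` is `Σ< u′ n * v n` plus the error of `u′` and
-- `v` at `n`. The unequal rates balance this: the shift costs a factor ¼ in `K`, so each of the two
-- contributions is at most `K * L * ½ ^ suc n`. Rate ½ for both series would allow an error of
-- order n · ½ ^ n.
cauchy-product : ∀ u v K L → (∀ k → ∣ u k ∣ ℚ.≤ K * ¼ ^ k) → (∀ k → ∣ v k ∣ ℚ.≤ L * ½ ^ k) →
                 ∀ n → ∣ Σ< u n * Σ< v n - Σ< (conv u v) n ∣ ℚ.≤ (K * L + K * L) * ½ ^ n
cauchy-product u v K L u≤ v≤ zero =
  subst (0ℚ ℚ.≤_) (sym (ℚₚ.*-identityʳ (K * L + K * L))) (ℚₚ.+-mono-≤ 0≤KL 0≤KL)
  where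
  0≤KL : 0ℚ ℚ.≤ K * L
  0≤KL = subst (ℚ._≤ K * L) (ℚₚ.*-zeroʳ K) (*-≤-nonNeg (bound⇒0≤K u K ¼ u≤) (bound⇒0≤K v L ½ v≤))
cauchy-product u v K L u≤ v≤ (suc n) = begin
  ∣ Σ< u (suc n) * Σ< v (suc n) - Σ< (conv u v) (suc n) ∣
    ≡⟨ cong ∣_∣ (trans (cong₂ (λ a b → a * Σ< v (suc n) - b) (Σ<-head u n) (Σ<-conv u v n))
         (solve 5 (λ a U V w C → (a :+ U) :* (V :+ w) :- (a :* (V :+ w) :+ C) := U :* w :+ (U :* V :- C)) refl
           (u 0) (Σ< u′ n) (Σ< v n) (v n) (Σ< (conv u′ v) n))) ⟩
  ∣ Σ< u′ n * v n + (Σ< u′ n * Σ< v n - Σ< (conv u′ v) n) ∣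
    ≤⟨ ∣+∣-≤ (∣*∣-≤ u′-sum (v≤ n)) (cauchy-product u′ v (K * ¼) L u′≤ v≤ n) ⟩
  (K * ¼ + K * ¼) * 1ℚ * (L * ½ ^ n) + (K * ¼ * L + K * ¼ * L) * ½ ^ n
    ≡⟨ solve 4 (λ k l q p → (k :* q :+ k :* q) :* con 1ℚ :* (l :* p) :+ (k :* q :* l :+ k :* q :* l) :* p
                         := (k :* l :+ k :* l) :* ((q :+ q) :* p)) refl K L ¼ (½ ^ n) ⟩
  -- `¼ + ¼` evaluates to `½`, so this already is the bound at `suc n`.
  (K * L + K * L) * ((¼ + ¼) * ½ ^ n)
    ∎
  where
  open ℚₚ.≤-Reasoning
  u′ = u ∘ suc
  u′≤ : ∀ k → ∣ u′ k ∣ ℚ.≤ K * ¼ * ¼ ^ k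
  u′≤ k = subst (∣ u′ k ∣ ℚ.≤_) (sym (ℚₚ.*-assoc K ¼ (¼ ^ k))) (u≤ (suc k))
  u′-sum : ∣ Σ< u′ n ∣ ℚ.≤ (K * ¼ + K * ¼) * 1ℚ
  u′-sum = subst (λ q → ∣ q ∣ ℚ.≤ (K * ¼ + K * ¼) * 1ℚ) (ℚₚ.+-identityʳ (Σ< u′ n))
    (Σ<-tail′ u′ (K * ¼) {0} {n} (¼-bound⇒½-bound u′ (K * ¼) u′≤) z≤n)

-- Equivalent to an infinite radius of convergence: the rate ¼ is arbitrary, since B may be enlarged.
Entire : (ℕ → ℚ) → Set
Entire f = ∀ B → ∃[ K ] (∀ x → ∣ x ∣ ℚ.≤ B → ∀ k → ∣ f k * x ^ k ∣ ℚ.≤ K * ¼ ^ k)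

psum : (ℕ → ℚ) → ℚ → ℕ → ℚ
psum f x = Σ< (λ k → f k * x ^ k)

powerSeries : (ℕ → ℚ) → ℝ → ℕ → ℝ
powerSeries f t = partialSum 0ᴿ _+ᴿ_ (λ k → fromℚ (f k) *ᴿ t ^ᴿ k)

seq-powerSeries : ∀ f t m n → seq (powerSeries f t m) n ≡ psum f (seq t n) m
seq-powerSeries f t zero    n = refl
seq-powerSeries f t (suc m) n = cong₂ _+_ (seq-powerSeries f t m n) (cong (f m *_) (seq-^ t m n))

diagonal : (ℕ → ℚ) → ℝ → ℕ → ℚ
diagonal f t n = psum f (seq t n) n

-- The tail estimate is uniform for `∣ x ∣ ≤ B`, hence valid at the moving argument `seq t n`. Once
-- `n ≥ m`, the `m`-th partial sum there differs from the diagonal by a tail that depends on `m`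
-- alone.
tends-powerSeries : ∀ f → Entire f → ∀ t → Tends (powerSeries f t) (diagonal f t)
tends-powerSeries f entire t ε 0<ε =
  let B , _ , N , t≤B = cauchy⇒bounded (seq t) (cauchy t)
      K , f≤ = entire B
      M , tail<ε = null-½^ (K + K) ε 0<ε
  in M , λ m M≤m → N ⊔ m , λ n ≤n →
    let x = seq t n
        u = λ k → f k * x ^ k
    in begin-strict
      ∣ seq (powerSeries f t m) n - Σ< u n ∣  ≡⟨ cong (λ q → ∣ q - Σ< u n ∣) (seq-powerSeries f t m n) ⟩
      ∣ Σ< u m - Σ< u n ∣                     ≡⟨ ∣∣-sym (Σ< u m) (Σ< u n) ⟩
      ∣ Σ< u n - Σ< u m ∣                     ≤⟨ Σ<-tail′ u K (¼-bound⇒½-bound u K (f≤ x (t≤B n (ℕₚ.m⊔n≤o⇒m≤o N m ≤n))))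
                                                   (ℕₚ.m⊔n≤o⇒n≤o N m ≤n) ⟩
      (K + K) * ½ ^ m                         ≤⟨ p≤∣p∣ _ ⟩
      ∣ (K + K) * ½ ^ m ∣                     <⟨ tail<ε m M≤m ⟩
      ε                                       ∎
  where open ℚₚ.≤-Reasoning

eval : ∀ f → Entire f → ℝ → ℝ
eval f entire t = mkℝ (diagonal f t) (tends-cauchy {powerSeries f t} (tends-powerSeries f entire t))

-- Both sides are evaluated at the same rational `seq t n` and cut off at the same length `n`, so
-- `cauchy-product` bounds their difference by a geometric sequence.
diagonal-conv : ∀ f g → Entire f → Entire g → ∀ t →
                (λ n → diagonal f t n * diagonal g t n) ≃ diagonal (conv f g) t
diagonal-conv f g entire-f entire-g t =
  let B , _ , N , t≤B = cauchy⇒bounded (seq t) (cauchy t)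
      K , f≤ = entire-f B
      L , g≤ = entire-g B
  in null-≤ N (λ n N≤n →
       let x = seq t n
           u = λ k → f k * x ^ k
           v = λ k → g k * x ^ k
       in subst (λ q → ∣ Σ< u n * Σ< v n - q ∣ ℚ.≤ (K * L + K * L) * ½ ^ n)
            (Σ<-cong (conv-^ f g x) n)
            (cauchy-product u v K L (f≤ x (t≤B n N≤n)) (¼-bound⇒½-bound v L (g≤ x (t≤B n N≤n))) n))
     (null-½^ (K * L + K * L))

psum-cong : ∀ {f g} → (∀ k → f k ≡ g k) → ∀ x n → psum f x n ≡ psum g x n
psum-cong f≗g x = Σ<-cong (λ k → cong (_* x ^ k) (f≗g k))

psum-+ : ∀ f g x n → psum (λ k → f k + g k) x n ≡ psum f x n + psum g x n
psum-+ f g x n = trans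
  (Σ<-cong (λ k → ℚₚ.*-distribʳ-+ (x ^ k) (f k) (g k)) n)
  (Σ<-+ (λ k → f k * x ^ k) (λ k → g k * x ^ k) n)

psum-scale : ∀ c f x n → psum (λ k → c * f k) x n ≡ c * psum f x n
psum-scale c f x n = trans
  (Σ<-cong (λ k → ℚₚ.*-assoc c (f k) (x ^ k)) n)
  (Σ<-scale c (λ k → f k * x ^ k) n)

-- Reciprocal factorials and exponential generating functions

1/!ℚ : ℕ → ℚ
1/!ℚ k = (ℤ.+ 1 / k ℕ.!) {{k ℕₚ.!≢0}}

1/!*! : ∀ k → 1/!ℚ k * ι (k ℕ.!) ≡ 1ℚ
1/!*! k = 1/ι (k ℕ.!) {{k ℕₚ.!≢0}}

suc*1/! : ∀ k → ι (suc k) * 1/!ℚ (suc k) ≡ 1/!ℚ k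
suc*1/! k = begin
  s * φ′                ≡⟨ ℚₚ.*-identityʳ (s * φ′) ⟨
  s * φ′ * 1ℚ           ≡⟨ cong (s * φ′ *_) (1/!*! k) ⟨
  s * φ′ * (φ * F)      ≡⟨ solve 4 (λ s φ′ φ F → s :* φ′ :* (φ :* F) := φ :* (φ′ :* (s :* F))) refl s φ′ φ F ⟩
  φ * (φ′ * (s * F))    ≡⟨ cong (λ q → φ * (φ′ * q)) (ι-* (suc k) (k ℕ.!)) ⟨
  φ * (φ′ * ι (suc k ℕ.!)) ≡⟨ cong (φ *_) (1/!*! (suc k)) ⟩
  φ * 1ℚ                ≡⟨ ℚₚ.*-identityʳ φ ⟩
  φ                     ∎
  where
  open ≡-Reasoning
  s = ι (suc k)
  φ = 1/!ℚ k
  φ′ = 1/!ℚ (suc k)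
  F = ι (k ℕ.!)

0≤1/! : ∀ k → 0ℚ ℚ.≤ 1/!ℚ k
0≤1/! k = ℚₚ.nonNegative⁻¹ (1/!ℚ k) {{ℚₚ.normalize-nonNeg 1 (k ℕ.!) {{k ℕₚ.!≢0}}}}

ι-^ : ∀ m k → ι (m ℕ.^ k) ≡ ι m ^ k
ι-^ m zero    = refl
ι-^ m (suc k) = trans (ι-* m (m ℕ.^ k)) (cong (ι m *_) (ι-^ m k))

∣^∣-≤ : ∀ {x B} → ∣ x ∣ ℚ.≤ B → ∀ k → ∣ x ^ k ∣ ℚ.≤ B ^ k
∣^∣-≤ x≤B zero    = ℚₚ.≤-refl
∣^∣-≤ x≤B (suc k) = ∣*∣-≤ x≤B (∣^∣-≤ x≤B k)

-- From the `m`-th factor on, each new factor `m` is matched by a factor of `k !` that is at least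
-- as large; the earlier ones are paid for by `m ^ m`. The resulting bound on `m ^ k / k !` is
-- uniform in `k`.
^≤^*! : ∀ m .{{_ : ℕ.NonZero m}} k → m ℕ.^ k ≤ m ℕ.^ m ℕ.* k ℕ.!
^≤^*! m zero = ℕₚ.≤-trans (ℕₚ.m^n>0 m m) (ℕₚ.m≤m*n (m ℕ.^ m) 1)
^≤^*! m (suc k) with ℕₚ.≤-total (suc k) m
... | inj₁ k<m = ℕₚ.≤-trans (ℕₚ.^-monoʳ-≤ m k<m) (ℕₚ.m≤m*n (m ℕ.^ m) (suc k ℕ.!) {{suc k ℕₚ.!≢0}})
... | inj₂ m≤k = ℕₚ.≤-trans (ℕₚ.*-mono-≤ m≤k (^≤^*! m k)) (ℕₚ.≤-reflexive
  (trans (sym (ℕₚ.*-assoc (suc k) (m ℕ.^ m) (k ℕ.!)))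
    (trans (cong (ℕ._* k ℕ.!) (ℕₚ.*-comm (suc k) (m ℕ.^ m))) (ℕₚ.*-assoc (m ℕ.^ m) (suc k) (k ℕ.!)))))

^*1/!≤ : ∀ m .{{_ : ℕ.NonZero m}} k → ι m ^ k * 1/!ℚ k ℚ.≤ ι (m ℕ.^ m)
^*1/!≤ m k = begin
  ι m ^ k * φ                       ≡⟨ cong (_* φ) (ι-^ m k) ⟨
  ι (m ℕ.^ k) * φ                   ≤⟨ ℚₚ.*-monoʳ-≤-nonNeg φ {{ℚ.nonNegative (0≤1/! k)}} (ι-mono (^≤^*! m k)) ⟩
  ι (m ℕ.^ m ℕ.* k ℕ.!) * φ         ≡⟨ cong (_* φ) (ι-* (m ℕ.^ m) (k ℕ.!)) ⟩
  ι (m ℕ.^ m) * ι (k ℕ.!) * φ       ≡⟨ solve 3 (λ a b c → a :* b :* c := a :* (c :* b)) refl (ι (m ℕ.^ m)) (ι (k ℕ.!)) φ ⟩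
  ι (m ℕ.^ m) * (φ * ι (k ℕ.!))     ≡⟨ cong (ι (m ℕ.^ m) *_) (1/!*! k) ⟩
  ι (m ℕ.^ m) * 1ℚ                  ≡⟨ ℚₚ.*-identityʳ (ι (m ℕ.^ m)) ⟩
  ι (m ℕ.^ m)                       ∎
  where
  open ℚₚ.≤-Reasoning
  φ = 1/!ℚ k

egf : (ℕ → ℚ) → ℕ → ℚ
egf p k = p k * 1/!ℚ k

egf-entire : ∀ p R → (∀ k → ∣ p k ∣ ℚ.≤ R ^ k) → Entire (egf p)
egf-entire p R p≤ B = ι (m ℕ.^ m) , bound
  where
  open ℚₚ.≤-Reasoning
  4ℚ = ℤ.+ 4 / 1
  -- The factor 4 pays for the decay `¼ ^ k` that `Entire` demands.
  c = 4ℚ * (R * B)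
  m₀ = proj₁ (≤ι ∣ c ∣)
  -- The successor supplies the non-zero base required by `^*1/!≤`.
  m = suc m₀
  c≤m : ∣ c ∣ ℚ.≤ ι m
  c≤m = ℚₚ.≤-trans (proj₂ (≤ι ∣ c ∣)) (ι-mono (ℕₚ.n≤1+n m₀))
  bound : ∀ x → ∣ x ∣ ℚ.≤ B → ∀ k → ∣ egf p k * x ^ k ∣ ℚ.≤ ι (m ℕ.^ m) * ¼ ^ k
  bound x x≤B k = begin
    ∣ p k * φ * x ^ k ∣          ≤⟨ ∣*∣-≤ (∣*∣-≤ (p≤ k) (ℚₚ.≤-reflexive (ℚₚ.0≤p⇒∣p∣≡p (0≤1/! k)))) (∣^∣-≤ x≤B k) ⟩
    R ^ k * φ * B ^ k            ≡⟨ solve 3 (λ r f b → r :* f :* b := r :* b :* f) refl (R ^ k) φ (B ^ k) ⟩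
    R ^ k * B ^ k * φ            ≡⟨ cong (_* φ) (^-distrib-* R B k) ⟨
    (R * B) ^ k * φ              ≡⟨ cong (λ q → q ^ k * φ) (trans (sym (ℚₚ.*-identityˡ (R * B))) (solve 1 (λ y → con (¼ * 4ℚ) :* y := con ¼ :* (con 4ℚ :* y)) refl (R * B))) ⟩
    (¼ * c) ^ k * φ              ≡⟨ cong (_* φ) (^-distrib-* ¼ c k) ⟩
    ¼ ^ k * c ^ k * φ            ≡⟨ ℚₚ.*-assoc (¼ ^ k) (c ^ k) φ ⟩
    ¼ ^ k * (c ^ k * φ)          ≤⟨ *-≤-nonNeg (0≤^ (ℚ.*≤* (ℤ.+≤+ z≤n)) k) (begin
      c ^ k * φ                  ≤⟨ ℚₚ.*-monoʳ-≤-nonNeg φ {{ℚ.nonNegative (0≤1/! k)}}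
                                      (ℚₚ.≤-trans (p≤∣p∣ (c ^ k)) (∣^∣-≤ c≤m k)) ⟩
      ι m ^ k * φ                ≤⟨ ^*1/!≤ m k ⟩
      ι (m ℕ.^ m)                ∎) ⟩
    ¼ ^ k * ι (m ℕ.^ m)          ≡⟨ ℚₚ.*-comm (¼ ^ k) (ι (m ℕ.^ m)) ⟩
    ι (m ℕ.^ m) * ¼ ^ k          ∎
    where φ = 1/!ℚ k

-- Formal derivatives

∂ : (ℕ → ℚ) → ℕ → ℚ
∂ f k = ι (suc k) * f (suc k)

-- Differentiation becomes the shift of `p`, so the recursions defining `P`, `Q` and `power` turn
-- into linear differential equations.
∂-egf : ∀ p k → ∂ (egf p) k ≡ egf (p ∘ suc) k
∂-egf p k = trans
  (solve 3 (λ s p f → s :* (p :* f) := p :* (s :* f)) refl (ι (suc k)) (p (suc k)) (1/!ℚ (suc k)))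
  (cong (p (suc k) *_) (suc*1/! k))

-- Positive integers are invertible in ℚ, so a derivative determines all coefficients but the
-- constant one. Identities of series follow by induction on the index, comparing constant terms and
-- then derivatives.
∂-injective : ∀ {f g} k → ∂ f k ≡ ∂ g k → f (suc k) ≡ g (suc k)
∂-injective {f} {g} k eq = trans (sym (undo f)) (trans (cong ((ℤ.+ 1 / suc k) *_) eq) (undo g))
  where
  undo : ∀ h → (ℤ.+ 1 / suc k) * ∂ h k ≡ h (suc k)
  undo h = trans (sym (ℚₚ.*-assoc (ℤ.+ 1 / suc k) (ι (suc k)) (h (suc k))))
    (trans (cong (_* h (suc k)) (1/ι (suc k))) (ℚₚ.*-identityˡ (h (suc k))))

-- The Leibniz rule. The induction passes to `u′` because (X u′)′ = u′ + X (u′)′, which in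
-- coefficients is `∂-suc`.
∂-conv : ∀ u v k → ∂ (conv u v) k ≡ conv (∂ u) v k + conv u (∂ v) k
∂-conv u v zero    = solve 5 (λ i a b c d → i :* (a :* d :+ c :* b) := i :* c :* b :+ a :* (i :* d)) refl
  (ι 1) (u 0) (v 0) (u 1) (v 1)
∂-conv u v (suc k) = begin
  ι (suc (suc k)) * (u 0 * v (suc (suc k)) + conv u′ v (suc k))
    ≡⟨ solve 4 (λ s a b c → s :* (a :* b :+ c) := a :* (s :* b) :+ s :* c) refl
         (ι (suc (suc k))) (u 0) (v (suc (suc k))) (conv u′ v (suc k)) ⟩
  u 0 * ∂ v (suc k) + ι (suc (suc k)) * conv u′ v (suc k)
    ≡⟨ cong (λ s → u 0 * ∂ v (suc k) + s * conv u′ v (suc k)) (ι-suc (suc k)) ⟩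
  u 0 * ∂ v (suc k) + (1ℚ + ι (suc k)) * conv u′ v (suc k)
    ≡⟨ solve 3 (λ x s c → x :+ (con 1ℚ :+ s) :* c := x :+ (c :+ s :* c)) refl
         (u 0 * ∂ v (suc k)) (ι (suc k)) (conv u′ v (suc k)) ⟩
  u 0 * ∂ v (suc k) + (conv u′ v (suc k) + ∂ (conv u′ v) k)
    ≡⟨ cong (λ y → u 0 * ∂ v (suc k) + (conv u′ v (suc k) + y)) (∂-conv u′ v k) ⟩
  u 0 * ∂ v (suc k) + (u′ 0 * v (suc k) + conv u″ v k + (conv (∂ u′) v k + conv u′ (∂ v) k))
    ≡⟨ solve 5 (λ x p q r s → x :+ (p :+ q :+ (r :+ s)) := p :+ (q :+ r) :+ (x :+ s)) refl
         (u 0 * ∂ v (suc k)) (u′ 0 * v (suc k)) (conv u″ v k) (conv (∂ u′) v k) (conv u′ (∂ v) k) ⟩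
  u′ 0 * v (suc k) + (conv u″ v k + conv (∂ u′) v k) + conv u (∂ v) (suc k)
    ≡⟨ cong (_+ conv u (∂ v) (suc k)) (cong₂ _+_ (cong (_* v (suc k)) (ℚₚ.*-identityˡ (u′ 0)))
         (trans (conv-cong {v = v} ∂-suc (λ _ → refl) k) (conv-+ˡ u″ (∂ u′) v k))) ⟨
  conv (∂ u) v (suc k) + conv u (∂ v) (suc k) ∎
  where
  open ≡-Reasoning
  u′ = u ∘ suc
  u″ = u′ ∘ suc
  ∂-suc : ∀ i → ∂ u (suc i) ≡ u″ i + ∂ u′ i
  ∂-suc i = trans (cong (_* u″ i) (ι-suc (suc i)))
    (solve 2 (λ s a → (con 1ℚ :+ s) :* a := a :+ s :* a) refl (ι (suc i)) (u″ i))

-- Trigonometry with angle √3 t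

3ℚ : ℚ
3ℚ = ℤ.+ 3 / 1

-- (P a k , Q a k) are the coordinates of (a S) ^ k with respect to 1 and S, where S² = -3; hence
-- C a and D a are the series of cos (√3 a t) and sin (√3 a t) / √3 as power series in t.
mutual
  P Q : ℚ → ℕ → ℚ
  P a zero    = 1ℚ
  P a (suc k) = - (3ℚ * a) * Q a k
  Q a zero    = 0ℚ
  Q a (suc k) = a * P a k

C D : ℚ → ℕ → ℚ
C a = egf (P a)
D a = egf (Q a)

PQ-bound : ∀ a k → let R = ∣ 3ℚ * a ∣ + ∣ a ∣ in ∣ P a k ∣ ℚ.≤ R ^ k × ∣ Q a k ∣ ℚ.≤ R ^ k
PQ-bound a zero    = ℚₚ.≤-refl , ℚₚ.<⇒≤ (ℚₚ.positive⁻¹ 1ℚ)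
PQ-bound a (suc k) =
    ∣*∣-≤ -3a≤R (proj₂ (PQ-bound a k))
  , ∣*∣-≤ a≤R (proj₁ (PQ-bound a k))
  where
  a≤R : ∣ a ∣ ℚ.≤ ∣ 3ℚ * a ∣ + ∣ a ∣
  a≤R = subst (ℚ._≤ ∣ 3ℚ * a ∣ + ∣ a ∣) (ℚₚ.+-identityˡ ∣ a ∣) (ℚₚ.+-monoˡ-≤ ∣ a ∣ (ℚₚ.0≤∣p∣ (3ℚ * a)))
  -3a≤R : ∣ - (3ℚ * a) ∣ ℚ.≤ ∣ 3ℚ * a ∣ + ∣ a ∣
  -3a≤R = subst₂ ℚ._≤_ (trans (ℚₚ.+-identityʳ _) (sym (ℚₚ.∣-p∣≡∣p∣ (3ℚ * a)))) refl
    (ℚₚ.+-monoʳ-≤ ∣ 3ℚ * a ∣ (ℚₚ.0≤∣p∣ a))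

C-entire : ∀ a → Entire (C a)
C-entire a = egf-entire (P a) (∣ 3ℚ * a ∣ + ∣ a ∣) (proj₁ ∘ PQ-bound a)

D-entire : ∀ a → Entire (D a)
D-entire a = egf-entire (Q a) (∣ 3ℚ * a ∣ + ∣ a ∣) (proj₂ ∘ PQ-bound a)

∂-C : ∀ a k → ∂ (C a) k ≡ - (3ℚ * a) * D a k
∂-C a k = trans (∂-egf (P a) k) (ℚₚ.*-assoc (- (3ℚ * a)) (Q a k) (1/!ℚ k))

∂-D : ∀ a k → ∂ (D a) k ≡ a * C a k
∂-D a k = trans (∂-egf (Q a) k) (ℚₚ.*-assoc a (P a k) (1/!ℚ k))

∂-conv-scale : ∀ {u u′ v v′} c d → (∀ k → ∂ u k ≡ c * u′ k) → (∀ k → ∂ v k ≡ d * v′ k) →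
               ∀ k → ∂ (conv u v) k ≡ c * conv u′ v k + d * conv u v′ k
∂-conv-scale {u} {u′} {v} {v′} c d ∂u ∂v k = trans (∂-conv u v k) (cong₂ _+_
  (trans (conv-cong {v = v} ∂u (λ _ → refl) k) (conv-scaleˡ c u′ v k))
  (trans (conv-cong {u = u} (λ _ → refl) ∂v k) (conv-scaleʳ d u v′ k)))

-- Both sides solve C′ = -3 (a + b) D, D′ = (a + b) C with the same constant terms. The system is
-- coupled, so the two formulas at `suc k` use each other at `k` and are proved together.
CD-addition : ∀ a b k →
    conv (C a) (C b) k + (- 3ℚ) * conv (D a) (D b) k ≡ C (a + b) k
  × conv (C a) (D b) k + conv (D a) (C b) k ≡ D (a + b) k
CD-addition a b zero    = refl , refl
CD-addition a b (suc k) =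
    ∂-injective {λ i → conv (C a) (C b) i + (- 3ℚ) * conv (D a) (D b) i} {C (a + b)} k (begin
      ι (suc k) * (conv (C a) (C b) (suc k) + (- 3ℚ) * conv (D a) (D b) (suc k))
        ≡⟨ solve 4 (λ s x t y → s :* (x :+ t :* y) := s :* x :+ t :* (s :* y)) refl
             (ι (suc k)) (conv (C a) (C b) (suc k)) (- 3ℚ) (conv (D a) (D b) (suc k)) ⟩
      ∂ (conv (C a) (C b)) k + (- 3ℚ) * ∂ (conv (D a) (D b)) k
        ≡⟨ cong₂ (λ x y → x + (- 3ℚ) * y)
             (∂-conv-scale (- (3ℚ * a)) (- (3ℚ * b)) (∂-C a) (∂-C b) k)
             (∂-conv-scale a b (∂-D a) (∂-D b) k) ⟩
      (- (3ℚ * a) * dc + - (3ℚ * b) * cd) + (- 3ℚ) * (a * cd + b * dc)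
        ≡⟨ solve 5 (λ t a b cd dc → (:- (t :* a) :* dc :+ :- (t :* b) :* cd) :+ (:- t) :* (a :* cd :+ b :* dc)
                                 := :- (t :* (a :+ b)) :* (cd :+ dc)) refl 3ℚ a b cd dc ⟩
      - (3ℚ * (a + b)) * (cd + dc)
        ≡⟨ cong (- (3ℚ * (a + b)) *_) (proj₂ (CD-addition a b k)) ⟩
      - (3ℚ * (a + b)) * D (a + b) k
        ≡⟨ ∂-C (a + b) k ⟨
      ∂ (C (a + b)) k ∎)
  , ∂-injective {λ i → conv (C a) (D b) i + conv (D a) (C b) i} {D (a + b)} k (begin
      ι (suc k) * (conv (C a) (D b) (suc k) + conv (D a) (C b) (suc k))
        ≡⟨ ℚₚ.*-distribˡ-+ (ι (suc k)) (conv (C a) (D b) (suc k)) (conv (D a) (C b) (suc k)) ⟩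
      ∂ (conv (C a) (D b)) k + ∂ (conv (D a) (C b)) k
        ≡⟨ cong₂ _+_ (∂-conv-scale (- (3ℚ * a)) b (∂-C a) (∂-D b) k)
                     (∂-conv-scale a (- (3ℚ * b)) (∂-D a) (∂-C b) k) ⟩
      (- (3ℚ * a) * dd + b * cc) + (a * cc + - (3ℚ * b) * dd)
        ≡⟨ solve 5 (λ t a b cc dd → (:- (t :* a) :* dd :+ b :* cc) :+ (a :* cc :+ :- (t :* b) :* dd)
                                 := (a :+ b) :* (cc :+ (:- t) :* dd)) refl 3ℚ a b cc dd ⟩
      (a + b) * (cc + (- 3ℚ) * dd)
        ≡⟨ cong ((a + b) *_) (proj₁ (CD-addition a b k)) ⟩
      (a + b) * C (a + b) k
        ≡⟨ ∂-D (a + b) k ⟨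
      ∂ (D (a + b)) k ∎)
  where
  open ≡-Reasoning
  cc = conv (C a) (C b) k
  cd = conv (C a) (D b) k
  dc = conv (D a) (C b) k
  dd = conv (D a) (D b) k

-- Evenness of the cosine and oddness of the sine, through which the addition formula at 1 and -1
-- becomes `null-pythagoras`.
PQ-neg : ∀ k → P (- 1ℚ) k ≡ P 1ℚ k × Q (- 1ℚ) k ≡ - 1ℚ * Q 1ℚ k
PQ-neg zero    = refl , refl
PQ-neg (suc k) =
    trans (cong (- (3ℚ * - 1ℚ) *_) (proj₂ (PQ-neg k)))
      (solve 2 (λ t q → :- (t :* con (- 1ℚ)) :* (con (- 1ℚ) :* q) := :- (t :* con 1ℚ) :* q) refl 3ℚ (Q 1ℚ k))
  , trans (cong (- 1ℚ *_) (proj₁ (PQ-neg k))) (cong (- 1ℚ *_) (sym (ℚₚ.*-identityˡ (P 1ℚ k))))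

psum-C-0 : ∀ x n → psum (C 0ℚ) x (suc n) ≡ 1ℚ
psum-C-0 x zero    = refl
psum-C-0 x (suc n) = trans (cong₂ _+_ (psum-C-0 x n)
  (solve 3 (λ q f p → (:- con 0ℚ) :* q :* f :* p := con 0ℚ) refl (Q 0ℚ n) (1/!ℚ (suc n)) (x ^ suc n)))
  (ℚₚ.+-identityʳ 1ℚ)

-- Addition formulas at a real argument

module _ (t : ℝ) where

  private
    c d : ℚ → ℕ → ℚ
    c a = diagonal (C a) t
    d a = diagonal (D a) t

  c-addition : ∀ a b → (λ n → c a n * c b n + (- 3ℚ) * (d a n * d b n)) ≃ c (a + b)
  c-addition a b = null-≗ (λ n → begin
    (c a n * c b n - S (conv (C a) (C b)) n) + (- 3ℚ) * (d a n * d b n - S (conv (D a) (D b)) n)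
      ≡⟨ solve 5 (λ x p t y q → (x :- p) :+ t :* (y :- q) := (x :+ t :* y) :- (p :+ t :* q)) refl
           (c a n * c b n) (S (conv (C a) (C b)) n) (- 3ℚ) (d a n * d b n) (S (conv (D a) (D b)) n) ⟩
    (c a n * c b n + (- 3ℚ) * (d a n * d b n)) - (S (conv (C a) (C b)) n + (- 3ℚ) * S (conv (D a) (D b)) n)
      ≡⟨ cong (λ q → (c a n * c b n + (- 3ℚ) * (d a n * d b n)) - q) (begin
           S (conv (C a) (C b)) n + (- 3ℚ) * S (conv (D a) (D b)) n
             ≡⟨ cong (S (conv (C a) (C b)) n +_) (psum-scale (- 3ℚ) (conv (D a) (D b)) (seq t n) n) ⟨
           S (conv (C a) (C b)) n + S (λ k → (- 3ℚ) * conv (D a) (D b) k) n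
             ≡⟨ psum-+ (conv (C a) (C b)) (λ k → (- 3ℚ) * conv (D a) (D b) k) (seq t n) n ⟨
           S (λ k → conv (C a) (C b) k + (- 3ℚ) * conv (D a) (D b) k) n
             ≡⟨ psum-cong (proj₁ ∘ CD-addition a b) (seq t n) n ⟩
           c (a + b) n ∎) ⟩
    (c a n * c b n + (- 3ℚ) * (d a n * d b n)) - c (a + b) n ∎)
    (null-+ (diagonal-conv (C a) (C b) (C-entire a) (C-entire b) t)
            (null-* (fromℚ (- 3ℚ)) (diagonal-conv (D a) (D b) (D-entire a) (D-entire b) t)))
    where
    open ≡-Reasoning
    S : (ℕ → ℚ) → ℕ → ℚ
    S f = diagonal f t

  d-addition : ∀ a b → (λ n → c a n * d b n + d a n * c b n) ≃ d (a + b)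
  d-addition a b = null-≗ (λ n → begin
    (c a n * d b n - S (conv (C a) (D b)) n) + (d a n * c b n - S (conv (D a) (C b)) n)
      ≡⟨ solve 4 (λ x p y q → (x :- p) :+ (y :- q) := (x :+ y) :- (p :+ q)) refl
           (c a n * d b n) (S (conv (C a) (D b)) n) (d a n * c b n) (S (conv (D a) (C b)) n) ⟩
    (c a n * d b n + d a n * c b n) - (S (conv (C a) (D b)) n + S (conv (D a) (C b)) n)
      ≡⟨ cong (λ q → (c a n * d b n + d a n * c b n) - q) (trans
           (sym (psum-+ (conv (C a) (D b)) (conv (D a) (C b)) (seq t n) n))
           (psum-cong (proj₂ ∘ CD-addition a b) (seq t n) n)) ⟩
    (c a n * d b n + d a n * c b n) - d (a + b) n ∎)
    (null-+ (diagonal-conv (C a) (D b) (C-entire a) (D-entire b) t)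
            (diagonal-conv (D a) (C b) (D-entire a) (C-entire b) t))
    where
    open ≡-Reasoning
    S : (ℕ → ℚ) → ℕ → ℚ
    S f = diagonal f t

  c-neg : ∀ n → c (- 1ℚ) n ≡ c 1ℚ n
  c-neg n = psum-cong (λ k → cong (_* 1/!ℚ k) (proj₁ (PQ-neg k))) (seq t n) n

  d-neg : ∀ n → d (- 1ℚ) n ≡ - 1ℚ * d 1ℚ n
  d-neg n = trans
    (psum-cong (λ k → trans (cong (_* 1/!ℚ k) (proj₂ (PQ-neg k))) (ℚₚ.*-assoc (- 1ℚ) (Q 1ℚ k) (1/!ℚ k))) (seq t n) n)
    (psum-scale (- 1ℚ) (D 1ℚ) (seq t n) n)

  null-pythagoras : Null (λ n → c 1ℚ n * c 1ℚ n + 3ℚ * (d 1ℚ n * d 1ℚ n) - 1ℚ)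
  null-pythagoras = null-≗ (λ n → trans
      (cong₂ (λ p q → (c 1ℚ n * p + (- 3ℚ) * (d 1ℚ n * q) - c 0ℚ n) + (c 0ℚ n - 1ℚ)) (c-neg n) (d-neg n))
      (solve 5 (λ c d t z o → (c :* c :+ (:- t) :* (d :* (con (- 1ℚ) :* d)) :- z) :+ (z :- o)
                           := c :* c :+ t :* (d :* d) :- o) refl (c 1ℚ n) (d 1ℚ n) 3ℚ (c 0ℚ n) 1ℚ))
    (null-+ (c-addition 1ℚ (- 1ℚ)) (null-≤ 1 c₀≤0 null-0))
    where
    -- Index 0 is excluded: the diagonal there is the empty sum 0, whereas every longer partial sum
    -- of `C 0ℚ` is exactly 1.
    c₀≤0 : ∀ n → 1 ≤ n → ∣ c 0ℚ n - 1ℚ ∣ ℚ.≤ 0ℚ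
    c₀≤0 (suc n) _ = ℚₚ.≤-reflexive (cong (λ q → ∣ q - 1ℚ ∣) (psum-C-0 (seq t (suc n)) n))

  -- From 0 ≈ D 3 = 3 D (1 - 4 D²) and D ≉ 0.
  quarter : Null (d 3ℚ) → ¬ Null (d 1ℚ) →
            Null (λ n → c 1ℚ n * c 1ℚ n - ¼) × Null (λ n → d 1ℚ n * d 1ℚ n - ¼)
  quarter null-d₃ ¬null-d₁ = null-cc , null-dd
    where
    2ℚ = ℤ.+ 2 / 1
    x y : ℝ
    x = eval (D 1ℚ) (D-entire 1ℚ) t
    y = fromℚ 3ℚ *ᴿ (1ᴿ -ᴿ fromℚ (ℤ.+ 4 / 1) *ᴿ (x *ᴿ x))
    c₁ = eval (C 1ℚ) (C-entire 1ℚ) t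

    null-xy : Null (λ n → seq x n * seq y n)
    null-xy = null-≗ (λ n →
      -- The first four summands replace d₃ by c d₂ + d c₂ and then expand the double angles, giving
      -- 3 c² d - 3 d³; subtracting 3 d (c² + 3 d² - 1) eliminates c and leaves 3 d (1 - 4 d²).
      solve 5 (λ c d c₂ d₂ d₃ →
          d₃ :+ ((c :* d₂ :+ d :* c₂) :- d₃) :+ c :* ((c :* d :+ d :* c) :- d₂)
             :+ d :* ((c :* c :+ con (- 3ℚ) :* (d :* d)) :- c₂)
             :+ :- (con 3ℚ :* (d :* (c :* c :+ con 3ℚ :* (d :* d) :- con 1ℚ)))
          := d :* (con 3ℚ :* (con 1ℚ :- con (ℤ.+ 4 / 1) :* (d :* d))))
        refl (c 1ℚ n) (d 1ℚ n) (c 2ℚ n) (d 2ℚ n) (d 3ℚ n))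
      (null-+ (null-+ (null-+ (null-+ null-d₃ (d-addition 1ℚ 2ℚ)) (null-* c₁ (d-addition 1ℚ 1ℚ)))
                      (null-* x (c-addition 1ℚ 1ℚ)))
              (null-neg (null-* (fromℚ 3ℚ) (null-* x null-pythagoras))))

    null-dd : Null (λ n → d 1ℚ n * d 1ℚ n - ¼)
    null-dd = null-≗ (λ n →
      solve 1 (λ d → con (- (ℤ.+ 1 / 12)) :* (con 3ℚ :* (con 1ℚ :- con (ℤ.+ 4 / 1) :* (d :* d))) := d :* d :- con ¼)
        refl (d 1ℚ n))
      (null-* (fromℚ (- (ℤ.+ 1 / 12))) (null-cancel x y null-xy ¬null-d₁))

    null-cc : Null (λ n → c 1ℚ n * c 1ℚ n - ¼)
    null-cc = null-≗ (λ n →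
      solve 2 (λ c d → (c :* c :+ con 3ℚ :* (d :* d) :- con 1ℚ) :+ con (- 3ℚ) :* (d :* d :- con ¼) := c :* c :- con ¼)
        refl (c 1ℚ n) (d 1ℚ n))
      (null-+ null-pythagoras (null-* (fromℚ (- 3ℚ)) null-dd))

-- The sine series as √3 times a rational series

^-double : ∀ x k → x ^ (2 ℕ.* k) ≡ (x * x) ^ k
^-double x k = trans (sym (^-assocʳ x 2 k)) (cong (λ q → (x * q) ^ k) (ℚₚ.*-identityʳ x))

-- Two steps of the recursion multiply by the scalar (a S)² = -3 a², so even powers of a S have no
-- component along S.
PQ-even : ∀ a k → P a (2 ℕ.* k) ≡ (- (3ℚ * a) * a) ^ k × Q a (2 ℕ.* k) ≡ 0ℚ
PQ-even a zero    = refl , refl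
PQ-even a (suc k) = subst (λ j → P a j ≡ z ^ suc k × Q a j ≡ 0ℚ) (sym (ℕₚ.*-suc 2 k))
  ( trans (sym (ℚₚ.*-assoc (- (3ℚ * a)) a (P a (2 ℕ.* k)))) (cong (z *_) (proj₁ (PQ-even a k)))
  , trans (cong (λ q → a * (- (3ℚ * a) * q)) (proj₂ (PQ-even a k)))
      (solve 2 (λ a y → a :* (y :* con 0ℚ) := con 0ℚ) refl a (- (3ℚ * a))))
  where z = - (3ℚ * a) * a

module _ {x r t : ℝ} (a : ℚ) (x≈art : x ≈ᴿ fromℚ a *ᴿ (r *ᴿ t)) (r²≈3 : r *ᴿ r ≈ᴿ 3ᴿ) where

  -- The odd power of `r` is `r` times a power of `r *ᴿ r`, and the latter may be replaced by 3. One
  -- factor `r` remains for all terms alike, and the powers of -1, 3 and `a` combine to `Q a j`.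
  sinTerm≈ : ∀ k → let j = suc (2 ℕ.* k) in sinTerm x k ≈ᴿ r *ᴿ (fromℚ (D a j) *ᴿ t ^ᴿ j)
  sinTerm≈ k =
    ≃-trans {seq (sinTerm x k)} {seq (s *ᴿ y ^ᴿ j)} (*ᴿ-congˡ s {x ^ᴿ j} {y ^ᴿ j} (^ᴿ-cong {x} {y} x≈art j))
    (≃-trans {seq (s *ᴿ y ^ᴿ j)} {seq (g *ᴿ (r *ᴿ r) ^ᴿ k)} (≃-reflexive split)
    (≃-trans {seq (g *ᴿ (r *ᴿ r) ^ᴿ k)} {seq (g *ᴿ 3ᴿ ^ᴿ k)} (*ᴿ-congˡ g {(r *ᴿ r) ^ᴿ k} {3ᴿ ^ᴿ k} (^ᴿ-cong {r *ᴿ r} {3ᴿ} r²≈3 k))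
      (≃-reflexive merge)))
    where
    open ≡-Reasoning
    j = suc (2 ℕ.* k)
    φ = 1/!ℚ j
    y s g : ℝ
    y = fromℚ a *ᴿ (r *ᴿ t)
    s = (-ᴿ 1ᴿ) ^ᴿ k *ᴿ 1/! j
    g = fromℚ ((- 1ℚ) ^ k * φ * a ^ j) *ᴿ (r *ᴿ t ^ᴿ j)

    r^j : ∀ n → seq r n ^ j ≡ seq r n * seq ((r *ᴿ r) ^ᴿ k) n
    r^j n = cong (seq r n *_) (trans (^-double (seq r n) k) (sym (seq-^ (r *ᴿ r) k n)))

    split : ∀ n → seq (s *ᴿ y ^ᴿ j) n ≡ seq (g *ᴿ (r *ᴿ r) ^ᴿ k) n
    split n = begin
      seq ((-ᴿ 1ᴿ) ^ᴿ k) n * φ * seq (y ^ᴿ j) n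
        ≡⟨ cong₂ (λ p q → p * φ * q) (seq-^ (-ᴿ 1ᴿ) k n) (seq-^ y j n) ⟩
      (- 1ℚ) ^ k * φ * (a * (seq r n * seq t n)) ^ j
        ≡⟨ cong ((- 1ℚ) ^ k * φ *_) (trans (^-distrib-* a (seq r n * seq t n) j)
             (cong (a ^ j *_) (trans (^-distrib-* (seq r n) (seq t n) j)
               (cong₂ _*_ (r^j n) (sym (seq-^ t j n)))))) ⟩
      (- 1ℚ) ^ k * φ * (a ^ j * (seq r n * R * seq (t ^ᴿ j) n))
        ≡⟨ solve 6 (λ m f a r q t → m :* f :* (a :* (r :* q :* t)) := m :* f :* a :* (r :* t) :* q) refl
             ((- 1ℚ) ^ k) φ (a ^ j) (seq r n) R (seq (t ^ᴿ j) n) ⟩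
      (- 1ℚ) ^ k * φ * a ^ j * (seq r n * seq (t ^ᴿ j) n) * R ∎
      where R = seq ((r *ᴿ r) ^ᴿ k) n

    Q-odd : (- 1ℚ) ^ k * a ^ j * 3ℚ ^ k ≡ Q a j
    Q-odd = begin
      (- 1ℚ) ^ k * (a * a ^ (2 ℕ.* k)) * 3ℚ ^ k
        ≡⟨ cong (λ q → (- 1ℚ) ^ k * (a * q) * 3ℚ ^ k) (^-double a k) ⟩
      (- 1ℚ) ^ k * (a * (a * a) ^ k) * 3ℚ ^ k
        ≡⟨ solve 4 (λ m a q t → m :* (a :* q) :* t := a :* (m :* t :* q)) refl ((- 1ℚ) ^ k) a ((a * a) ^ k) (3ℚ ^ k) ⟩
      a * ((- 1ℚ) ^ k * 3ℚ ^ k * (a * a) ^ k)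
        ≡⟨ cong (a *_) (trans (^-distrib-* (- 1ℚ * 3ℚ) (a * a) k) (cong (_* (a * a) ^ k) (^-distrib-* (- 1ℚ) 3ℚ k))) ⟨
      a * ((- 1ℚ * 3ℚ) * (a * a)) ^ k
        ≡⟨ cong (λ q → a * q ^ k) (solve 2 (λ a t → (con (- 1ℚ) :* t) :* (a :* a) := :- (t :* a) :* a) refl a 3ℚ) ⟩
      a * (- (3ℚ * a) * a) ^ k
        ≡⟨ cong (a *_) (proj₁ (PQ-even a k)) ⟨
      Q a j ∎

    merge : ∀ n → seq (g *ᴿ 3ᴿ ^ᴿ k) n ≡ seq (r *ᴿ (fromℚ (D a j) *ᴿ t ^ᴿ j)) n
    merge n = begin
      (- 1ℚ) ^ k * φ * a ^ j * (seq r n * T) * seq (3ᴿ ^ᴿ k) n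
        ≡⟨ cong ((- 1ℚ) ^ k * φ * a ^ j * (seq r n * T) *_) (seq-^ 3ᴿ k n) ⟩
      (- 1ℚ) ^ k * φ * a ^ j * (seq r n * T) * 3ℚ ^ k
        ≡⟨ solve 6 (λ m f a r t h → m :* f :* a :* (r :* t) :* h := r :* (m :* a :* h :* f :* t)) refl
             ((- 1ℚ) ^ k) φ (a ^ j) (seq r n) T (3ℚ ^ k) ⟩
      seq r n * ((- 1ℚ) ^ k * a ^ j * 3ℚ ^ k * φ * T)
        ≡⟨ cong (λ q → seq r n * (q * φ * T)) Q-odd ⟩
      seq r n * (Q a j * φ * T) ∎
      where T = seq (t ^ᴿ j) n

  -- Even coefficients of `D a` vanish, so `m` terms of the sine series match `2 m` terms of `D a`.
  sin-partialSum : ∀ m → r *ᴿ powerSeries (D a) t (2 ℕ.* m) ≈ᴿ partialSum 0ᴿ _+ᴿ_ (sinTerm x) m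
  sin-partialSum zero    = ≃-reflexive (λ n → ℚₚ.*-zeroʳ (seq r n))
  sin-partialSum (suc m) = subst (λ j → r *ᴿ powerSeries (D a) t j ≈ᴿ partialSum 0ᴿ _+ᴿ_ (sinTerm x) (suc m))
    (sym (ℕₚ.*-suc 2 m)) (null-≗ (λ n → trans
      (solve 5 (λ r S T p s → (r :* S :- p) :+ :- (s :- r :* T) := r :* (S :+ con 0ℚ :+ T) :- (p :+ s)) refl
        (seq r n) (seq (powerSeries (D a) t j) n) (seq (fromℚ (D a (suc j)) *ᴿ t ^ᴿ suc j) n)
        (seq (partialSum 0ᴿ _+ᴿ_ (sinTerm x) m) n) (seq (sinTerm x m) n))
      (cong (λ q → seq r n * (seq (powerSeries (D a) t j) n + q + seq (fromℚ (D a (suc j)) *ᴿ t ^ᴿ suc j) n)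
                   - (seq (partialSum 0ᴿ _+ᴿ_ (sinTerm x) m) n + seq (sinTerm x m) n))
        (sym (even-term n))))
    (null-+ (sin-partialSum m) (null-neg (sinTerm≈ m))))
    where
    j = 2 ℕ.* m
    even-term : ∀ n → D a j * seq (t ^ᴿ j) n ≡ 0ℚ
    even-term n = trans (cong (λ q → q * 1/!ℚ j * seq (t ^ᴿ j) n) (proj₂ (PQ-even a m)))
      (solve 2 (λ f t → con 0ℚ :* f :* t := con 0ℚ) refl (1/!ℚ j) (seq (t ^ᴿ j) n))

  sin-tends : Tends (partialSum 0ᴿ _+ᴿ_ (sinTerm x)) (λ n → seq r n * diagonal (D a) t n)
  sin-tends = tends-resp {λ m → r *ᴿ powerSeries (D a) t (2 ℕ.* m)} {partialSum 0ᴿ _+ᴿ_ (sinTerm x)} {λ n → seq r n * diagonal (D a) t n} {λ n → seq r n * diagonal (D a) t n}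
    sin-partialSum (≃-reflexive {λ n → seq r n * diagonal (D a) t n} (λ _ → refl))
    (tends-scale r {λ m → powerSeries (D a) t (2 ℕ.* m)} {diagonal (D a) t}
      (tends-subsequence {powerSeries (D a) t} (2 ℕ.*_) (λ m → ℕₚ.m≤m+n m (m ℕ.+ 0)) (tends-powerSeries (D a) (D-entire a) t)))

  -- The factor `r` is removed by multiplying with `⅓ r`: d = ⅓ (r (r d) - d (r² - 3)), where r d is
  -- null by uniqueness of limits.
  sin-zero⇒null : IsSin x 0ᴿ → Null (diagonal (D a) t)
  sin-zero⇒null sin = null-≗ (λ n →
      solve 3 (λ r d s → con (ℤ.+ 1 / 3) :* (r :* (r :* d :- con 0ℚ) :+ :- (d :* (r :* r :- con 3ℚ))) := d) refl
        (seq r n) (diagonal (D a) t n) 0ℚ)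
    (null-* (fromℚ (ℤ.+ 1 / 3)) (null-+
      (null-* r (tends-unique {partialSum 0ᴿ _+ᴿ_ (sinTerm x)} {λ n → seq r n * diagonal (D a) t n} {λ _ → 0ℚ} sin-tends (⟶⇒tends {partialSum 0ᴿ _+ᴿ_ (sinTerm x)} 0ᴿ sin)))
      (null-neg (null-* (eval (D a) (D-entire a) t) r²≈3))))

  null⇒sin-zero : Null (diagonal (D a) t) → IsSin x 0ᴿ
  null⇒sin-zero null = tends⇒⟶ {partialSum 0ᴿ _+ᴿ_ (sinTerm x)} 0ᴿ (tends-resp {partialSum 0ᴿ _+ᴿ_ (sinTerm x)} {partialSum 0ᴿ _+ᴿ_ (sinTerm x)} {λ n → seq r n * diagonal (D a) t n} {λ _ → 0ℚ}
    (λ m → ≃-reflexive {seq (partialSum 0ᴿ _+ᴿ_ (sinTerm x) m)} (λ _ → refl))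
    (null-≗ (λ n → sym (ℚₚ.+-identityʳ _)) (null-* r null)) sin-tends)

-- cos (π / 3) and sin (π / 3) / √3 up to sign: leastness of π is what excludes sin (π / 3) = 0.
quarter-at-π : ∀ π √3 t → IsPi π → IsPositiveSqrt 3ᴿ √3 → t *ᴿ (3ᴿ *ᴿ √3) ≈ᴿ π →
               Null (λ n → diagonal (C 1ℚ) t n * diagonal (C 1ℚ) t n - ¼)
             × Null (λ n → diagonal (D 1ℚ) t n * diagonal (D 1ℚ) t n - ¼)
quarter-at-π π √3 t (0<π , sin-π , least) (_ , √3²≈3) 3√3t≈π =
  quarter t (sin-zero⇒null {π} {√3} {t} 3ℚ π≈ √3²≈3 sin-π)
    λ null → least θ 0<θ θ<π (null⇒sin-zero {θ} {√3} {t} 1ℚ θ≈ √3²≈3 null)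
  where
  θ : ℝ
  θ = √3 *ᴿ t
  π≈ : π ≈ᴿ fromℚ 3ℚ *ᴿ θ
  π≈ = null-≗ (λ n → solve 3 (λ p r t → :- (t :* (con 3ℚ :* r) :- p) := p :- con 3ℚ :* (r :* t)) refl
    (seq π n) (seq √3 n) (seq t n)) (null-neg 3√3t≈π)
  θ≈ : θ ≈ᴿ fromℚ 1ℚ *ᴿ θ
  θ≈ = ≃-reflexive (λ n → sym (ℚₚ.*-identityˡ (seq θ n)))

  ⅓ : ℚ
  ⅓ = ℤ.+ 1 / 3

  -- Both inequalities say that π is positive, as θ ≈ π / 3.
  scaled : ∀ r → 0ℚ ℚ.< r → ∀ x → x ≈ᴿ fromℚ r *ᴿ π → 0ᴿ <ᴿ x
  scaled r 0<r x x≈ =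
    let δ , 0<δ , N , p = 0<π
        0<rδ = subst (ℚ._< r * δ) (ℚₚ.*-zeroʳ r) (ℚₚ.*-monoʳ-<-pos r {{ℚ.positive 0<r}} 0<δ)
        η = ½ * (r * δ)
        M , q = x≈ η (0<½* 0<rδ)
    in η , 0<½* 0<rδ , N ⊔ M , λ n ≤n → begin-strict
      η                                             ≡⟨ solve 1 (λ h → h := h :+ h :+ :- h) refl η ⟩
      η + η + - η                                   ≡⟨ cong (_+ - η) (½+½ (r * δ)) ⟩
      r * δ + - η                                   <⟨ ℚₚ.+-mono-< (ℚₚ.*-monoʳ-<-pos r {{ℚ.positive 0<r}} (p n (ℕₚ.m⊔n≤o⇒m≤o N M ≤n)))
                                                         (ℚₚ.neg-antimono-< (ℚₚ.≤-<-trans (p≤∣p∣ _)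
                                                           (subst (ℚ._< η) (∣∣-sym (seq x n) (r * seq π n)) (q n (ℕₚ.m⊔n≤o⇒n≤o N M ≤n))))) ⟩
      r * (seq π n - 0ℚ) + - (r * seq π n - seq x n)  ≡⟨ solve 3 (λ r p x → r :* (p :- con 0ℚ) :+ :- (r :* p :- x) := x :- con 0ℚ) refl r (seq π n) (seq x n) ⟩
      seq x n - 0ℚ                                  ∎
    where open ℚₚ.≤-Reasoning

  0<θ : 0ᴿ <ᴿ θ
  0<θ = scaled ⅓ (ℚₚ.positive⁻¹ ⅓) θ (null-≗ (λ n →
    solve 2 (λ p s → (:- con ⅓) :* (p :- con 3ℚ :* s) := s :- con ⅓ :* p) refl (seq π n) (seq θ n))
    (null-* (fromℚ (- ⅓)) π≈))

  θ<π : θ <ᴿ π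
  θ<π =
    let δ , 0<δ , N , p = scaled (ℤ.+ 2 / 3) (ℚₚ.positive⁻¹ (ℤ.+ 2 / 3)) (π -ᴿ θ) (null-≗ (λ n →
          solve 2 (λ p s → con ⅓ :* (p :- con 3ℚ :* s) := (p :- s) :- con (ℤ.+ 2 / 3) :* p) refl (seq π n) (seq θ n))
          (null-* (fromℚ ⅓) π≈))
    in δ , 0<δ , N , λ n N≤n → subst (δ ℚ.<_) (ℚₚ.+-identityʳ (seq π n - seq θ n)) (p n N≤n)

-- Matrix exponentials and Kronecker sums

δ : ∀ {n} → Fin n → Fin n → ℚ
δ a b = if does (a Fin.≟ b) then 1ℚ else 0ℚ

δ-≡ : ∀ {n} {a b : Fin n} → a ≡ b → δ a b ≡ 1ℚ
δ-≡ {a = a} {b} a≡b with a Fin.≟ b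
... | yes _  = refl
... | no a≢b = contradiction a≡b a≢b

δ-≢ : ∀ {n} {a b : Fin n} → a ≢ b → δ a b ≡ 0ℚ
δ-≢ {a = a} {b} a≢b with a Fin.≟ b
... | yes a≡b = contradiction a≡b a≢b
... | no _    = refl

δ-sym : ∀ {n} (a b : Fin n) → δ a b ≡ δ b a
δ-sym a b with a Fin.≟ b
... | yes a≡b = sym (δ-≡ (sym a≡b))
... | no  a≢b = sym (δ-≢ (≢-sym a≢b))

sum-zero : ∀ {n} {f : Fin n → ℚ} → (∀ i → f i ≡ 0ℚ) → sum f ≡ 0ℚ
sum-zero {zero}  f≡0 = refl
sum-zero {suc n} f≡0 = cong₂ _+_ (f≡0 zero) (sum-zero (f≡0 ∘ suc))

sum-δˡ : ∀ {n} a (f : Fin n → ℚ) → sum (λ i → δ a i * f i) ≡ f a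
sum-δˡ zero    f = trans (cong₂ _+_ (ℚₚ.*-identityˡ (f zero)) (sum-zero (λ i → ℚₚ.*-zeroˡ (f (suc i)))))
  (ℚₚ.+-identityʳ (f zero))
sum-δˡ (suc a) f = trans (cong₂ _+_ (ℚₚ.*-zeroˡ (f zero)) (sum-δˡ a (f ∘ suc))) (ℚₚ.+-identityˡ (f (suc a)))

sum-↑ : ∀ m {n} (f : Fin (m ℕ.+ n) → ℚ) → sum f ≡ sum (λ i → f (i ↑ˡ n)) + sum (λ j → f (m ↑ʳ j))
sum-↑ zero    f = sym (ℚₚ.+-identityˡ (sum f))
sum-↑ (suc m) f = trans (cong (f zero +_) (sum-↑ m (f ∘ suc))) (sym (ℚₚ.+-assoc (f zero) _ _))

sum-combine : ∀ m {n} (f : Fin (m ℕ.* n) → ℚ) → sum f ≡ sum (λ i → sum (λ j → f (combine {m} i j)))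
sum-combine zero        f = refl
sum-combine (suc m) {n} f = trans (sum-↑ n f)
  (cong (sum (λ j → f (j ↑ˡ m ℕ.* n)) +_) (sum-combine m (λ i → f (n ↑ʳ i))))

∣sum∣-≤ : ∀ {n} (f g : Fin n → ℚ) {B} → (∀ i → ∣ g i ∣ ℚ.≤ B) →
          ∣ sum (λ i → f i * g i) ∣ ℚ.≤ sum (λ i → ∣ f i ∣) * B
∣sum∣-≤ {zero}  f g {B} g≤B = ℚₚ.≤-reflexive (sym (ℚₚ.*-zeroˡ B))
∣sum∣-≤ {suc n} f g {B} g≤B = ℚₚ.≤-trans
  (∣+∣-≤ (∣*∣-≤ {f zero} ℚₚ.≤-refl (g≤B zero)) (∣sum∣-≤ (f ∘ suc) (g ∘ suc) (g≤B ∘ suc)))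
  (ℚₚ.≤-reflexive (sym (ℚₚ.*-distribʳ-+ B ∣ f zero ∣ (sum (λ i → ∣ f (suc i) ∣)))))

0≤sum : ∀ {n} {f : Fin n → ℚ} → (∀ i → 0ℚ ℚ.≤ f i) → 0ℚ ℚ.≤ sum f
0≤sum {zero}  0≤f = ℚₚ.≤-refl
0≤sum {suc n} 0≤f = ℚₚ.+-mono-≤ (0≤f zero) (0≤sum (0≤f ∘ suc))

≤sum : ∀ {n} {f : Fin n → ℚ} → (∀ i → 0ℚ ℚ.≤ f i) → ∀ i → f i ℚ.≤ sum f
≤sum {f = f} 0≤f zero    = subst (ℚ._≤ sum f) (ℚₚ.+-identityʳ (f zero)) (ℚₚ.+-monoʳ-≤ (f zero) (0≤sum (0≤f ∘ suc)))
≤sum {f = f} 0≤f (suc i) = subst (ℚ._≤ sum f) (ℚₚ.+-identityˡ (f (suc i))) (ℚₚ.+-mono-≤ (0≤f zero) (≤sum (0≤f ∘ suc) i))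

power : ∀ {n} → Matrix ℚ n → ℕ → Matrix ℚ n
power M zero    a b = δ a b
power M (suc k) a b = sum (λ c → M a c * power M k c b)

expSeries : ∀ {n} → Matrix ℚ n → Fin n → Fin n → ℕ → ℚ
expSeries M a b = egf (λ k → power M k a b)

-- The sum over all entries dominates every absolute row sum, so its powers bound all entries of the
-- matrix powers at once.
norm : ∀ {n} → Matrix ℚ n → ℚ
norm M = sum (λ a → sum (λ c → ∣ M a c ∣))

power-≤ : ∀ {n} (M : Matrix ℚ n) a b k → ∣ power M k a b ∣ ℚ.≤ norm M ^ k
power-≤ M a b zero with a Fin.≟ b
... | yes _ = ℚₚ.≤-refl
... | no  _ = ℚₚ.<⇒≤ (ℚₚ.positive⁻¹ 1ℚ)
power-≤ M a b (suc k) = ℚₚ.≤-trans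
  (∣sum∣-≤ (M a) (λ c → power M k c b) (λ c → power-≤ M c b k))
  (ℚₚ.*-monoʳ-≤-nonNeg (norm M ^ k)
    {{ℚ.nonNegative (0≤^ (0≤sum {f = λ a → sum (λ c → ∣ M a c ∣)} row≥0) k)}}
    (≤sum {f = λ a → sum (λ c → ∣ M a c ∣)} row≥0 a))
  where
  row≥0 : ∀ a → 0ℚ ℚ.≤ sum (λ c → ∣ M a c ∣)
  row≥0 a = 0≤sum (λ c → ℚₚ.0≤∣p∣ (M a c))

expSeries-entire : ∀ {n} (M : Matrix ℚ n) a b → Entire (expSeries M a b)
expSeries-entire M a b = egf-entire (λ k → power M k a b) (norm M) (power-≤ M a b)

-- The differential equation E′ = M E for E(x) = exp (x M), read entry by entry.
∂-expSeries : ∀ {n} (M : Matrix ℚ n) a b k →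
              ∂ (expSeries M a b) k ≡ sum (λ c → M a c * expSeries M c b k)
∂-expSeries M a b k = trans (∂-egf (λ i → power M i a b) k)
  (trans (*-distribʳ-sum (1/!ℚ k) (λ c → M a c * power M k c b))
    (sum-cong-≗ (λ c → ℚₚ.*-assoc (M a c) (power M k c b) (1/!ℚ k))))

conv-zeroˡ : ∀ v k → conv (λ _ → 0ℚ) v k ≡ 0ℚ
conv-zeroˡ v zero    = ℚₚ.*-zeroˡ (v 0)
conv-zeroˡ v (suc k) = cong₂ _+_ (ℚₚ.*-zeroˡ (v (suc k))) (conv-zeroˡ v k)

conv-zeroʳ : ∀ u k → conv u (λ _ → 0ℚ) k ≡ 0ℚ
conv-zeroʳ u zero    = ℚₚ.*-zeroʳ (u 0)
conv-zeroʳ u (suc k) = cong₂ _+_ (ℚₚ.*-zeroʳ (u 0)) (conv-zeroʳ (u ∘ suc) k)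

conv-sumˡ : ∀ {n} (w : Fin n → ℚ) (f : Fin n → ℕ → ℚ) v k →
            conv (λ i → sum (λ c → w c * f c i)) v k ≡ sum (λ c → w c * conv (f c) v k)
conv-sumˡ {zero}  w f v k = conv-zeroˡ v k
conv-sumˡ {suc n} w f v k = trans
  (conv-+ˡ (λ i → w zero * f zero i) (λ i → sum (λ c → w (suc c) * f (suc c) i)) v k)
  (cong₂ _+_ (conv-scaleˡ (w zero) (f zero) v k) (conv-sumˡ (w ∘ suc) (f ∘ suc) v k))

conv-sumʳ : ∀ {n} (w : Fin n → ℚ) u (f : Fin n → ℕ → ℚ) k →
            conv u (λ i → sum (λ c → w c * f c i)) k ≡ sum (λ c → w c * conv u (f c) k)
conv-sumʳ {zero}  w u f k = conv-zeroʳ u k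
conv-sumʳ {suc n} w u f k = trans
  (conv-+ʳ u (λ i → w zero * f zero i) (λ i → sum (λ c → w (suc c) * f (suc c) i)) k)
  (cong₂ _+_ (conv-scaleʳ (w zero) u (f zero) k) (conv-sumʳ (w ∘ suc) u (f ∘ suc) k))

-- Kronecker sums and their exponentials

infixl 6 _⊕_
_⊕_ : ∀ {m n} → Matrix ℚ m → Matrix ℚ n → Matrix ℚ (m ℕ.* n)
_⊕_ {m} {n} A B a b =
    A (quotient n a) (quotient n b) * δ (remainder {m} n a) (remainder {m} n b)
  + δ (quotient {m} n a) (quotient n b) * B (remainder {m} n a) (remainder {m} n b)

module _ {m n} (A : Matrix ℚ m) (B : Matrix ℚ n) where

  private
    q : Fin (m ℕ.* n) → Fin m
    q = quotient n
    r : Fin (m ℕ.* n) → Fin n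
    r = remainder {m} n

  δ-remQuot : ∀ a b → δ a b ≡ δ (q a) (q b) * δ (r a) (r b)
  δ-remQuot a b with a Fin.≟ b
  ... | yes a≡b = sym (cong₂ _*_ (δ-≡ (cong q a≡b)) (δ-≡ (cong r a≡b)))
  ... | no  a≢b with q a Fin.≟ q b
  ...   | no  _   = sym (ℚₚ.*-zeroˡ (δ (r a) (r b)))
  ...   | yes qa≡qb = sym (trans (ℚₚ.*-identityˡ (δ (r a) (r b))) (δ-≢ λ ra≡rb → a≢b
          (trans (sym (combine-remQuot {m} n a)) (trans (cong₂ combine qa≡qb ra≡rb) (combine-remQuot {m} n b)))))

  -- The sum over vertex pairs becomes a double sum, in each half of which a `δ` collapses one of
  -- the two indices.
  sum-⊕ : ∀ a (F : Fin m → Fin n → ℚ) →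
          sum (λ c → (A ⊕ B) a c * F (q c) (r c))
            ≡ sum (λ i → A (q a) i * F i (r a)) + sum (λ j → B (r a) j * F (q a) j)
  sum-⊕ a F = begin
    sum (λ c → (A ⊕ B) a c * F (q c) (r c))
      ≡⟨ sum-combine m {n} (λ c → (A ⊕ B) a c * F (q c) (r c)) ⟩
    sum (λ i → sum (λ j → (A ⊕ B) a (combine {m} {n} i j) * F (q (combine i j)) (r (combine i j))))
      -- `quotient` and `remainder` are the projections of `remQuot`, so a single equation of pairs
      -- rewrites all their occurrences.
      ≡⟨ sum-cong-≗ (λ i → sum-cong-≗ (λ j → cong
           (λ (i′ , j′) → (A (q a) i′ * δ (r a) j′ + δ (q a) i′ * B (r a) j′) * F i′ j′)
           (remQuot-combine {m} {n} i j))) ⟩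
    sum (λ i → sum (λ j → (A (q a) i * δ (r a) j + δ (q a) i * B (r a) j) * F i j))
      ≡⟨ sum-cong-≗ (λ i → begin
           sum (λ j → (A (q a) i * δ (r a) j + δ (q a) i * B (r a) j) * F i j)
             ≡⟨ sum-cong-≗ (λ j → solve 5 (λ x d e b f → (x :* d :+ e :* b) :* f := d :* (x :* f) :+ e :* (b :* f)) refl
                  (A (q a) i) (δ (r a) j) (δ (q a) i) (B (r a) j) (F i j)) ⟩
           sum (λ j → δ (r a) j * (A (q a) i * F i j) + δ (q a) i * (B (r a) j * F i j))
             ≡⟨ ∑-distrib-+ (λ j → δ (r a) j * (A (q a) i * F i j)) (λ j → δ (q a) i * (B (r a) j * F i j)) ⟩
           sum (λ j → δ (r a) j * (A (q a) i * F i j)) + sum (λ j → δ (q a) i * (B (r a) j * F i j))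
             ≡⟨ cong₂ _+_ (sum-δˡ (r a) (λ j → A (q a) i * F i j))
                  (sym (*-distribˡ-sum (δ (q a) i) (λ j → B (r a) j * F i j))) ⟩
           A (q a) i * F i (r a) + δ (q a) i * sum (λ j → B (r a) j * F i j) ∎) ⟩
    sum (λ i → A (q a) i * F i (r a) + δ (q a) i * sum (λ j → B (r a) j * F i j))
      ≡⟨ ∑-distrib-+ (λ i → A (q a) i * F i (r a)) (λ i → δ (q a) i * sum (λ j → B (r a) j * F i j)) ⟩
    sum (λ i → A (q a) i * F i (r a)) + sum (λ i → δ (q a) i * sum (λ j → B (r a) j * F i j))
      ≡⟨ cong (sum (λ i → A (q a) i * F i (r a)) +_) (sum-δˡ (q a) (λ i → sum (λ j → B (r a) j * F i j))) ⟩
    sum (λ i → A (q a) i * F i (r a)) + sum (λ j → B (r a) j * F (q a) j) ∎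
    where open ≡-Reasoning

  -- exp (A ⊕ B) = exp A ⊗ exp B: by the Leibniz rule the right side also satisfies E′ = (A ⊕ B) E,
  -- and both sides start from the identity matrix. The row `a` varies in the induction, since E′ at
  -- row `a` involves every row.
  expSeries-⊕ : ∀ k a b → expSeries (A ⊕ B) a b k
                        ≡ conv (expSeries A (q a) (q b)) (expSeries B (r a) (r b)) k
  expSeries-⊕ zero a b = trans (cong (_* 1/!ℚ 0) (δ-remQuot a b))
    (solve 2 (λ x y → x :* y :* con 1ℚ := x :* con 1ℚ :* (y :* con 1ℚ)) refl (δ (q a) (q b)) (δ (r a) (r b)))
  expSeries-⊕ (suc k) a b =
    ∂-injective {expSeries (A ⊕ B) a b} {conv (eA (q a)) (eB (r a))} k (begin
      ∂ (expSeries (A ⊕ B) a b) k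
        ≡⟨ ∂-expSeries (A ⊕ B) a b k ⟩
      sum (λ c → (A ⊕ B) a c * expSeries (A ⊕ B) c b k)
        ≡⟨ sum-cong-≗ (λ c → cong ((A ⊕ B) a c *_) (expSeries-⊕ k c b)) ⟩
      sum (λ c → (A ⊕ B) a c * conv (eA (q c)) (eB (r c)) k)
        ≡⟨ sum-⊕ a (λ i j → conv (eA i) (eB j) k) ⟩
      sum (λ i → A (q a) i * conv (eA i) (eB (r a)) k) + sum (λ j → B (r a) j * conv (eA (q a)) (eB j) k)
        ≡⟨ cong₂ _+_
             (trans (conv-cong {v = eB (r a)} (∂-expSeries A (q a) (q b)) (λ _ → refl) k)
                    (conv-sumˡ (A (q a)) eA (eB (r a)) k))
             (trans (conv-cong {u = eA (q a)} (λ _ → refl) (∂-expSeries B (r a) (r b)) k)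
                    (conv-sumʳ (B (r a)) (eA (q a)) eB k)) ⟨
      conv (∂ (eA (q a))) (eB (r a)) k + conv (eA (q a)) (∂ (eB (r a))) k
        ≡⟨ ∂-conv (eA (q a)) (eB (r a)) k ⟨
      ∂ (conv (eA (q a)) (eB (r a))) k ∎)
    where
    open ≡-Reasoning
    eA : Fin m → ℕ → ℚ
    eA i = expSeries A i (q b)
    eB : Fin n → ℕ → ℚ
    eB j = expSeries B j (r b)

1/order-* : ∀ m n (a : Fin (m ℕ.* n)) →
            1/order a ≡ 1/order (quotient {m} n a) * 1/order (remainder {m} n a)
1/order-* m n a = begin
  x                          ≡⟨ ℚₚ.*-identityʳ x ⟨
  x * (1ℚ * 1ℚ)              ≡⟨ cong₂ (λ u v → x * (u * v)) (1/ι m {{nonZeroIndex (quotient {m} n a)}}) (1/ι n {{nonZeroIndex (remainder {m} n a)}}) ⟨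
  x * (y * ι m * (z * ι n))  ≡⟨ solve 5 (λ x y z m n → x :* (y :* m :* (z :* n)) := y :* z :* (x :* (m :* n))) refl x y z (ι m) (ι n) ⟩
  y * z * (x * (ι m * ι n))  ≡⟨ cong (λ q → y * z * (x * q)) (ι-* m n) ⟨
  y * z * (x * ι (m ℕ.* n))  ≡⟨ cong (y * z *_) (1/ι (m ℕ.* n) {{nonZeroIndex a}}) ⟩
  y * z * 1ℚ                 ≡⟨ ℚₚ.*-identityʳ (y * z) ⟩
  y * z                      ∎
  where
  open ≡-Reasoning
  x = 1/order a
  y = 1/order (quotient {m} n a)
  z = 1/order (remainder {m} n a)

-- Uniform mixing for a real exponential, where the squared modulus of an entry is its square,
-- expressed through the diagonals of the entries.
Flat : ∀ {n} → Matrix ℚ n → ℝ → Set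
Flat M t = ∀ a b → Null (λ n → diagonal (expSeries M a b) t n * diagonal (expSeries M a b) t n - 1/order a)

⊕-flat : ∀ {m n} (A : Matrix ℚ m) (B : Matrix ℚ n) {t} → Flat A t → Flat B t → Flat (A ⊕ B) t
⊕-flat {m} {n} A B {t} flat-A flat-B a b =
  ≃-trans {seq (e *ᴿ e)} {seq (x *ᴿ y *ᴿ (x *ᴿ y))} (*ᴿ-cong {e} {x *ᴿ y} {e} {x *ᴿ y} e≈xy e≈xy)
  (≃-trans {seq (x *ᴿ y *ᴿ (x *ᴿ y))} {seq (x *ᴿ x *ᴿ (y *ᴿ y))}
    (≃-reflexive (λ k → solve 2 (λ x y → x :* y :* (x :* y) := x :* x :* (y :* y)) refl (seq x k) (seq y k)))
  (≃-trans {seq (x *ᴿ x *ᴿ (y *ᴿ y))} {seq (fromℚ p *ᴿ fromℚ s)}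
    (*ᴿ-cong {x *ᴿ x} {fromℚ p} {y *ᴿ y} {fromℚ s} (flat-A (quotient n a) (quotient n b)) (flat-B (remainder {m} n a) (remainder {m} n b)))
    (≃-reflexive (λ _ → sym (1/order-* m n a)))))
  where
  fA = expSeries A (quotient n a) (quotient n b)
  fB = expSeries B (remainder {m} n a) (remainder {m} n b)
  p = 1/order (quotient {m} n a)
  s = 1/order (remainder {m} n a)
  fA-entire = expSeries-entire A (quotient n a) (quotient n b)
  fB-entire = expSeries-entire B (remainder {m} n a) (remainder {m} n b)
  x y e : ℝ
  x = eval fA fA-entire t
  y = eval fB fB-entire t
  e = eval (expSeries (A ⊕ B) a b) (expSeries-entire (A ⊕ B) a b) t
  e≈xy : e ≈ᴿ x *ᴿ y
  e≈xy = ≃-sym {seq (x *ᴿ y)} (≃-trans {seq (x *ᴿ y)} {diagonal (conv fA fB) t}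
    (diagonal-conv fA fB fA-entire fB-entire t)
    (≃-reflexive (λ k → psum-cong (λ i → sym (expSeries-⊕ A B i a b)) (seq t k) k)))

-- Orientations of Hamming graphs

-- Left multiplication by the quaternion -(i + j + k) in the basis 1, i, j, k, whose square is -3.
-- As an orientation: a cyclic triangle and a fourth vertex joined to its corners in the same
-- direction.
S₄ : Matrix ℚ 4
S₄ = Vector.fromList (row 0ℚ 1ℚ 1ℚ 1ℚ ∷ row (- 1ℚ) 0ℚ 1ℚ (- 1ℚ) ∷ row (- 1ℚ) (- 1ℚ) 0ℚ 1ℚ ∷ row (- 1ℚ) 1ℚ (- 1ℚ) 0ℚ ∷ [])
  where
  row : ℚ → ℚ → ℚ → ℚ → Fin 4 → ℚ
  row w x y z = Vector.fromList (w ∷ x ∷ y ∷ z ∷ [])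

S₄²≡-3 : ∀ a b → sum (λ c → S₄ a c * S₄ c b) ≡ - 3ℚ * δ a b
S₄²≡-3 = from-yes (all? λ a → all? λ b → sum (λ c → S₄ a c * S₄ c b) ℚ.≟ - 3ℚ * δ a b)

power-S₄ : ∀ k a b → power S₄ k a b ≡ P 1ℚ k * δ a b + Q 1ℚ k * S₄ a b
power-S₄ zero    a b = solve 2 (λ d s → d := con 1ℚ :* d :+ con 0ℚ :* s) refl (δ a b) (S₄ a b)
power-S₄ (suc k) a b = begin
  sum (λ c → S₄ a c * power S₄ k c b)
    ≡⟨ sum-cong-≗ (λ c → trans (cong (S₄ a c *_) (trans (power-S₄ k c b) (cong (λ d → p * d + q * S₄ c b) (δ-sym c b))))
         (solve 5 (λ s p d q s′ → s :* (p :* d :+ q :* s′) := d :* (p :* s) :+ q :* (s :* s′)) refl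
           (S₄ a c) p (δ b c) q (S₄ c b))) ⟩
  sum (λ c → δ b c * (p * S₄ a c) + q * (S₄ a c * S₄ c b))
    ≡⟨ ∑-distrib-+ (λ c → δ b c * (p * S₄ a c)) (λ c → q * (S₄ a c * S₄ c b)) ⟩
  sum (λ c → δ b c * (p * S₄ a c)) + sum (λ c → q * (S₄ a c * S₄ c b))
    ≡⟨ cong₂ _+_ (sum-δˡ b (λ c → p * S₄ a c)) (trans (sym (*-distribˡ-sum q (λ c → S₄ a c * S₄ c b))) (cong (q *_) (S₄²≡-3 a b))) ⟩
  p * S₄ a b + q * (- 3ℚ * δ a b)
    ≡⟨ solve 5 (λ p s q t d → p :* s :+ q :* (:- t :* d) := :- (t :* con 1ℚ) :* q :* d :+ con 1ℚ :* p :* s) refl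
         p (S₄ a b) q 3ℚ (δ a b) ⟩
  - (3ℚ * 1ℚ) * q * δ a b + 1ℚ * p * S₄ a b ∎
  where
  open ≡-Reasoning
  p = P 1ℚ k
  q = Q 1ℚ k

psum-S₄ : ∀ x n a b → psum (expSeries S₄ a b) x n ≡ δ a b * psum (C 1ℚ) x n + S₄ a b * psum (D 1ℚ) x n
psum-S₄ x n a b = begin
  psum (expSeries S₄ a b) x n
    ≡⟨ psum-cong (λ k → trans (cong (_* 1/!ℚ k) (power-S₄ k a b))
         (solve 5 (λ p d q s f → (p :* d :+ q :* s) :* f := d :* (p :* f) :+ s :* (q :* f)) refl
           (P 1ℚ k) (δ a b) (Q 1ℚ k) (S₄ a b) (1/!ℚ k))) x n ⟩
  psum (λ k → δ a b * C 1ℚ k + S₄ a b * D 1ℚ k) x n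
    ≡⟨ psum-+ (λ k → δ a b * C 1ℚ k) (λ k → S₄ a b * D 1ℚ k) x n ⟩
  psum (λ k → δ a b * C 1ℚ k) x n + psum (λ k → S₄ a b * D 1ℚ k) x n
    ≡⟨ cong₂ _+_ (psum-scale (δ a b) (C 1ℚ) x n) (psum-scale (S₄ a b) (D 1ℚ) x n) ⟩
  δ a b * psum (C 1ℚ) x n + S₄ a b * psum (D 1ℚ) x n ∎
  where open ≡-Reasoning

-- The weights i S a b on the edges of X form an orientation with Hermitian matrix i S.
record SkewMatrix (X : Graph) : Set where
  field
    entries  : Matrix ℚ (order X)
    skew     : ∀ a b → entries b a ≡ - entries a b
    edge     : ∀ a b → Adj X a b → entries a b ≡ 1ℚ ⊎ entries a b ≡ - 1ℚ
    non-edge : ∀ a b → ¬ Adj X a b → entries a b ≡ 0ℚ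
open SkewMatrix

skew-K₄ : SkewMatrix (K 4)
skew-K₄ = record
  { entries  = S₄
  ; skew     = from-yes (all? λ a → all? λ b → S₄ b a ℚ.≟ - S₄ a b)
  ; edge     = from-yes (all? λ a → all? λ b →
                 ¬? (a Fin.≟ b) →-dec ((S₄ a b ℚ.≟ 1ℚ) ⊎-dec (S₄ a b ℚ.≟ - 1ℚ)))
  ; non-edge = from-yes (all? λ a → all? λ b → ¬? (¬? (a Fin.≟ b)) →-dec (S₄ a b ℚ.≟ 0ℚ))
  }

-- By irreflexivity an edge in one coordinate excludes equality in that coordinate. Hence on an edge
-- of the product one summand of the Kronecker sum vanishes and the other is ±1.
skew-□ : ∀ {X Y} → SkewMatrix X → SkewMatrix Y → SkewMatrix (X □ Y)
skew-□ {X} {Y} S T = record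
  { entries  = entries S ⊕ entries T
  ; skew     = λ a b → trans
      (cong₂ _+_ (cong₂ _*_ (skew S (q a) (q b)) (δ-sym (r b) (r a)))
                 (cong₂ _*_ (δ-sym (q b) (q a)) (skew T (r a) (r b))))
      (solve 4 (λ s d e t → :- s :* d :+ e :* :- t := :- (s :* d :+ e :* t)) refl
        (entries S (q a) (q b)) (δ (r a) (r b)) (δ (q a) (q b)) (entries T (r a) (r b)))
  ; edge     = λ
      { a b (inj₁ (e , p)) → subst ±1 (sym (trans
          (cong₂ (λ d d′ → entries S (q a) (q b) * d + d′ * entries T (r a) (r b))
            (δ-≡ p) (δ-≢ λ qa≡qb → irrefl X (subst (Adj X (q a)) (sym qa≡qb) e)))
          (solve 2 (λ s t → s :* con 1ℚ :+ con 0ℚ :* t := s) refl (entries S (q a) (q b)) (entries T (r a) (r b)))))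
          (edge S (q a) (q b) e)
      ; a b (inj₂ (p , e)) → subst ±1 (sym (trans
          (cong₂ (λ d d′ → entries S (q a) (q b) * d + d′ * entries T (r a) (r b))
            (δ-≢ λ ra≡rb → irrefl Y (subst (Adj Y (r a)) (sym ra≡rb) e)) (δ-≡ p))
          (solve 2 (λ s t → s :* con 0ℚ :+ con 1ℚ :* t := t) refl (entries S (q a) (q b)) (entries T (r a) (r b)))))
          (edge T (r a) (r b) e)
      }
  ; non-edge = λ a b ¬e → cong₂ _+_
      (product-zero (r a Fin.≟ r b) λ p → non-edge S (q a) (q b) λ e → ¬e (inj₁ (e , p)))
      (trans (ℚₚ.*-comm (δ (q a) (q b)) _)
        (product-zero (q a Fin.≟ q b) λ p → non-edge T (r a) (r b) λ e → ¬e (inj₂ (p , e))))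
  }
  where
  q : Fin (order X ℕ.* order Y) → Fin (order X)
  q = quotient (order Y)
  r : Fin (order X ℕ.* order Y) → Fin (order Y)
  r = remainder {order X} (order Y)
  ±1 : ℚ → Set
  ±1 s = s ≡ 1ℚ ⊎ s ≡ - 1ℚ
  product-zero : ∀ {n} {a b : Fin n} {s} → Dec (a ≡ b) → (a ≡ b → s ≡ 0ℚ) → s * δ a b ≡ 0ℚ
  product-zero {a = a} {b} (yes a≡b) s≡0 = trans (cong (_* δ a b) (s≡0 a≡b)) (ℚₚ.*-zeroˡ (δ a b))
  product-zero {s = s} (no a≢b) _ = trans (cong (s *_) (δ-≢ a≢b)) (ℚₚ.*-zeroʳ s)

-- Indexed from dimension 1, where the iterated product is `K 4` itself; both clauses then match
-- `_□^_` definitionally.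
skew-H : ∀ n → SkewMatrix (H (suc n) 4)
skew-H zero    = skew-K₄
skew-H (suc n) = skew-□ skew-K₄ (skew-H n)

module _ (t : ℝ)
         (null-cc : Null (λ n → diagonal (C 1ℚ) t n * diagonal (C 1ℚ) t n - ¼))
         (null-dd : Null (λ n → diagonal (D 1ℚ) t n * diagonal (D 1ℚ) t n - ¼)) where

  -- By `psum-S₄` the exponential has `C` on its diagonal and `± D` elsewhere, and `1/order`
  -- evaluates to `¼`.
  flat-K₄ : Flat S₄ t
  flat-K₄ a b with a Fin.≟ b
  ... | yes a≡b = null-≗ (λ n → cong (λ e → e * e - ¼) (sym (trans (psum-S₄ (seq t n) n a b)
      (trans (cong₂ (λ d s → d * diagonal (C 1ℚ) t n + s * diagonal (D 1ℚ) t n) (δ-≡ a≡b) (non-edge skew-K₄ a b λ a≢b → a≢b a≡b))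
        (solve 2 (λ c d → con 1ℚ :* c :+ con 0ℚ :* d := c) refl (diagonal (C 1ℚ) t n) (diagonal (D 1ℚ) t n)))))) null-cc
  ... | no a≢b = null-≗ (λ n → cong (_- ¼) (trans
      (sq n (edge skew-K₄ a b a≢b))
      (sym (cong (λ e → e * e) (trans (psum-S₄ (seq t n) n a b)
        (trans (cong (λ d → d * diagonal (C 1ℚ) t n + S₄ a b * diagonal (D 1ℚ) t n) (δ-≢ a≢b))
          (solve 2 (λ c d → con 0ℚ :* c :+ d := d) refl (diagonal (C 1ℚ) t n) (S₄ a b * diagonal (D 1ℚ) t n)))))))) null-dd
    where
    sq : ∀ n → S₄ a b ≡ 1ℚ ⊎ S₄ a b ≡ - 1ℚ →
         let d = diagonal (D 1ℚ) t n in d * d ≡ S₄ a b * d * (S₄ a b * d)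
    sq n (inj₁ p) = trans (solve 1 (λ d → d :* d := con 1ℚ :* d :* (con 1ℚ :* d)) refl (diagonal (D 1ℚ) t n))
      (cong (λ s → s * diagonal (D 1ℚ) t n * (s * diagonal (D 1ℚ) t n)) (sym p))
    sq n (inj₂ p) = trans (solve 1 (λ d → d :* d := con (- 1ℚ) :* d :* (con (- 1ℚ) :* d)) refl (diagonal (D 1ℚ) t n))
      (cong (λ s → s * diagonal (D 1ℚ) t n * (s * diagonal (D 1ℚ) t n)) (sym p))

  flat-H : ∀ n → Flat (entries (skew-H n)) t
  flat-H zero    = flat-K₄
  flat-H (suc n) = ⊕-flat S₄ (entries (skew-H n)) {t} flat-K₄ (flat-H n)

-- The complex matrix exponential reduced to the rational series

foldr-re : ∀ {k} (f : Fin k → ℂ) n → seq (re (Vector.foldr _+ᶜ_ 0ᶜ f)) n ≡ sum (λ i → seq (re (f i)) n)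
foldr-re {zero}  f n = refl
foldr-re {suc k} f n = cong (seq (re (f zero)) n +_) (foldr-re (f ∘ suc) n)

foldr-im : ∀ {k} (f : Fin k → ℂ) n → seq (im (Vector.foldr _+ᶜ_ 0ᶜ f)) n ≡ sum (λ i → seq (im (f i)) n)
foldr-im {zero}  f n = refl
foldr-im {suc k} f n = cong (seq (im (f zero)) n +_) (foldr-im (f ∘ suc) n)

∣fromℝ∣² : ∀ x p → x *ᴿ x ≈ᴿ fromℚ p → fromℝ x *ᶜ conj (fromℝ x) ≈ᶜ fromℝ (fromℚ p)
∣fromℝ∣² x p x²≈p =
    null-≗ (λ n → solve 2 (λ x p → x :* x :- p := (x :* x :- con 0ℚ :* (:- con 0ℚ)) :- p) refl (seq x n) p) x²≈p
  , ≃-reflexive (λ n → solve 1 (λ x → x :* (:- con 0ℚ) :+ con 0ℚ :* x := con 0ℚ) refl (seq x n))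

module _ {k} (M : Matrix ℂ k) (S : Matrix ℚ k) (t : ℝ)
         (re-M : ∀ a b n → seq (re (M a b)) n ≡ seq t n * S a b)
         (im-M : ∀ a b n → seq (im (M a b)) n ≡ 0ℚ) where

  mutual
    -- The exponent is the real matrix t S. Its entries are given exactly at each approximation
    -- index `n`, not just up to `_≈ᴿ_`, so powers are computed by congruence and ring identities
    -- without estimates.
    re-M^ : ∀ k a b n → seq (re ((M ^ᴹ k) a b)) n ≡ seq t n ^ k * power S k a b
    re-M^ zero    a b n with a Fin.≟ b
    ... | yes _ = refl
    ... | no  _ = refl
    re-M^ (suc k) a b n = begin
      seq (re ((M ^ᴹ suc k) a b)) n
        ≡⟨ foldr-re (λ c → M a c *ᶜ (M ^ᴹ k) c b) n ⟩
      sum (λ c → seq (re (M a c)) n * seq (re ((M ^ᴹ k) c b)) n - seq (im (M a c)) n * seq (im ((M ^ᴹ k) c b)) n)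
        ≡⟨ sum-cong-≗ (λ c → trans
             (cong₂ _-_ (cong₂ _*_ (re-M a c n) (re-M^ k c b n)) (cong₂ _*_ (im-M a c n) (im-M^ k c b n)))
             (solve 4 (λ t s p m → (t :* s) :* (p :* m) :- con 0ℚ :* con 0ℚ := t :* p :* (s :* m)) refl
               (seq t n) (S a c) (seq t n ^ k) (power S k c b))) ⟩
      sum (λ c → seq t n * seq t n ^ k * (S a c * power S k c b))
        ≡⟨ *-distribˡ-sum (seq t n ^ suc k) (λ c → S a c * power S k c b) ⟨
      seq t n ^ suc k * power S (suc k) a b ∎
      where open ≡-Reasoning

    im-M^ : ∀ k a b n → seq (im ((M ^ᴹ k) a b)) n ≡ 0ℚ
    im-M^ zero    a b n with a Fin.≟ b
    ... | yes _ = refl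
    ... | no  _ = refl
    im-M^ (suc k) a b n = trans (foldr-im (λ c → M a c *ᶜ (M ^ᴹ k) c b) n)
      (sum-zero (λ c → trans
        (cong₂ (λ x y → seq (re (M a c)) n * x + y * seq (re ((M ^ᴹ k) c b)) n) (im-M^ k c b n) (im-M a c n))
        (solve 2 (λ x y → x :* con 0ℚ :+ con 0ℚ :* y := con 0ℚ) refl (seq (re (M a c)) n) (seq (re ((M ^ᴹ k) c b)) n))))

  expTerm : Fin k → Fin k → ℕ → ℂ
  expTerm a b k = (fromℝ (1/! k) ·ᴹ M ^ᴹ k) a b

  re-partialSum : ∀ a b m n → seq (re (partialSum 0ᶜ _+ᶜ_ (expTerm a b) m)) n ≡ psum (expSeries S a b) (seq t n) m
  re-partialSum a b zero    n = refl
  re-partialSum a b (suc m) n = cong₂ _+_ (re-partialSum a b m n) (trans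
    (cong₂ (λ x y → 1/!ℚ m * x - 0ℚ * y) (re-M^ m a b n) (im-M^ m a b n))
    (solve 3 (λ f p s → f :* (p :* s) :- con 0ℚ :* con 0ℚ := s :* f :* p) refl
      (1/!ℚ m) (seq t n ^ m) (power S m a b)))

  im-partialSum : ∀ a b m n → seq (im (partialSum 0ᶜ _+ᶜ_ (expTerm a b) m)) n ≡ 0ℚ
  im-partialSum a b zero    n = refl
  im-partialSum a b (suc m) n = cong₂ _+_ (im-partialSum a b m n) (trans
    (cong₂ (λ x y → 1/!ℚ m * y + 0ℚ * x) (re-M^ m a b n) (im-M^ m a b n))
    (solve 2 (λ f x → f :* con 0ℚ :+ con 0ℚ :* x := con 0ℚ) refl (1/!ℚ m) (seq t n ^ m * power S m a b)))

  expEntry : Fin k → Fin k → ℝ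
  expEntry a b = eval (expSeries S a b) (expSeries-entire S a b) t

  isExp : IsExp M (λ a b → fromℝ (expEntry a b))
  isExp a b =
      tends⇒⟶ {λ m → re (partialSum 0ᶜ _+ᶜ_ (expTerm a b) m)} (expEntry a b)
        (tends-resp {powerSeries f t} {λ m → re (partialSum 0ᶜ _+ᶜ_ (expTerm a b) m)} {diagonal f t} {diagonal f t}
          (λ m → ≃-reflexive (λ n → trans (seq-powerSeries f t m n) (sym (re-partialSum a b m n))))
          (≃-reflexive {diagonal f t} (λ _ → refl))
          (tends-powerSeries f (expSeries-entire S a b) t))
    , tends⇒⟶ {λ m → im (partialSum 0ᶜ _+ᶜ_ (expTerm a b) m)} 0ᴿ
        (λ ε 0<ε → 0 , λ m _ → 0 , λ n _ →
          subst (λ x → ∣ x - 0ℚ ∣ ℚ.< ε) (sym (im-partialSum a b m n)) 0<ε)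
    where f = expSeries S a b

uniformMixing : ∀ {k} (A : Matrix ℂ k) (S : Matrix ℚ k) t →
                (∀ a b n → seq (re (((-ᶜ (𝕚 *ᶜ fromℝ t)) ·ᴹ A) a b)) n ≡ seq t n * S a b) →
                (∀ a b n → seq (im (((-ᶜ (𝕚 *ᶜ fromℝ t)) ·ᴹ A) a b)) n ≡ 0ℚ) →
                Flat S t → HasUniformMixing A t
uniformMixing A S t re-exponent im-exponent flat =
    (λ a b → fromℝ (u a b))
  , isExp ((-ᶜ (𝕚 *ᶜ fromℝ t)) ·ᴹ A) S t re-exponent im-exponent
  , λ a b → ∣fromℝ∣² (u a b) (1/order a) (flat a b)
  where u = expEntry ((-ᶜ (𝕚 *ᶜ fromℝ t)) ·ᴹ A) S t re-exponent im-exponent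

-- From skew matrices to orientations with uniform mixing

module _ {X : Graph} (S : SkewMatrix X) where

  weights : Fin (order X) → Fin (order X) → ℂ
  weights a b = 0ᴿ +i fromℚ (entries S a b)

  re-signed : ∀ a b n → seq (re (signedMatrix X weights a b)) n ≡ 0ℚ
  re-signed a b n with adj? X a b
  ... | yes _ = refl
  ... | no  _ = refl

  im-signed : ∀ a b n → seq (im (signedMatrix X weights a b)) n ≡ entries S a b
  im-signed a b n with adj? X a b
  ... | yes _ = refl
  ... | no ¬e = sym (non-edge S a b ¬e)

  orientation : Signing X
  orientation = record
    { weight    = weights
    ; nonzero   = λ a b e → λ (_ , im≈0) → ≢0 (edge S a b e)
        (trans (sym (ℚₚ.+-identityʳ (entries S a b))) (null-const (entries S a b - 0ℚ) im≈0))
    ; hermitian = λ a b →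
        ≃-reflexive (λ n → trans (re-signed b a n) (sym (re-signed a b n)))
      , ≃-reflexive (λ n → trans (im-signed b a n) (trans (skew S a b) (cong -_ (sym (im-signed a b n)))))
    }
    where
    ≢0 : ∀ {s} → s ≡ 1ℚ ⊎ s ≡ - 1ℚ → s ≢ 0ℚ
    ≢0 (inj₁ refl) ()
    ≢0 (inj₂ refl) ()

  isOrientation : IsOrientation orientation
  isOrientation a b e with edge S a b e
  ... | inj₁ s≡1  = inj₁ (≃-reflexive {λ _ → 0ℚ} (λ _ → refl) , ≃-reflexive (λ _ → s≡1))
  ... | inj₂ s≡-1 = inj₂ (≃-reflexive {λ _ → 0ℚ} (λ _ → refl) , ≃-reflexive (λ _ → s≡-1))

  re-exponent : ∀ t a b n → seq (re (((-ᶜ (𝕚 *ᶜ fromℝ t)) ·ᴹ matrix orientation) a b)) n ≡ seq t n * entries S a b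
  re-exponent t a b n = trans
    (cong₂ (λ x y → (- (0ℚ * seq t n - 1ℚ * 0ℚ)) * x - (- (0ℚ * 0ℚ + 1ℚ * seq t n)) * y) (re-signed a b n) (im-signed a b n))
    (solve 2 (λ t s → (:- (con 0ℚ :* t :- con 1ℚ :* con 0ℚ)) :* con 0ℚ :- (:- (con 0ℚ :* con 0ℚ :+ con 1ℚ :* t)) :* s := t :* s) refl
      (seq t n) (entries S a b))

  im-exponent : ∀ t a b n → seq (im (((-ᶜ (𝕚 *ᶜ fromℝ t)) ·ᴹ matrix orientation) a b)) n ≡ 0ℚ
  im-exponent t a b n = trans
    (cong₂ (λ x y → (- (0ℚ * seq t n - 1ℚ * 0ℚ)) * y + (- (0ℚ * 0ℚ + 1ℚ * seq t n)) * x) (re-signed a b n) (im-signed a b n))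
    (solve 2 (λ t s → (:- (con 0ℚ :* t :- con 1ℚ :* con 0ℚ)) :* s :+ (:- (con 0ℚ :* con 0ℚ :+ con 1ℚ :* t)) :* con 0ℚ := con 0ℚ) refl
      (seq t n) (entries S a b))

  flat⇒uniformMixing : ∀ t → Flat (entries S) t → HasUniformMixing (matrix orientation) t
  flat⇒uniformMixing t = uniformMixing (matrix orientation) (entries S) t (re-exponent t) (im-exponent t)

theorem3 : (n : ℕ) → 1 ≤ n →
    Σ[ σ ∈ Signing (H n 4) ]
    IsOrientation σ
    × ((π √3 t : ℝ) → IsPi π → IsPositiveSqrt 3ᴿ √3 → t *ᴿ (3ᴿ *ᴿ √3) ≈ᴿ π →
    HasUniformMixing (matrix σ) t)
theorem3 (suc n) _ =
  orientation S , isOrientation S , λ π √3 t isPi isSqrt 3√3t≈π →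
    let null-cc , null-dd = quarter-at-π π √3 t isPi isSqrt 3√3t≈π
    in flat⇒uniformMixing S t (flat-H t null-cc null-dd n)
  where S = skew-H n
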